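{- Let $n$ be a positive integer and let $O(n)$ be the symmetric Jordan basis of $V(B(n))$ produced by the linear BTK algorithm applied to the Boolean algebra $B(n)$ (defined in the context). Let $\langle\,,\rangle$ be the standard inner product on $V(B(n))$ and $\|v\|=\sqrt{\langle v,v\rangle}$. Then: (i) The elements of $O(n)$ are (pairwise) orthogonal with respect to $\langle\,,\rangle$. (ii) Let $0\le k\le\lfloor n/2\rfloor$ and let $(x_k,\ldots,x_{n-k})$ and $(y_k,\ldots,y_{n-k})$ be any two symmetric Jordan chains in $O(n)$ starting at rank $k$ and ending at rank $n-k$. Then $$\frac{\|x_{u+1}\|}{\|x_u\|}=\frac{\|y_{u+1}\|}{\|y_u\|},\qquad k\le u<n-k.$$ (iii) In the notation of part (ii), for $k\le u<n-k$, $$\frac{\|x_{u+1}\|}{\|x_u\|}=\sqrt{(u+1-k)(n-k-u)}=(n-k-u)\binom{n-2k}{u-k}^{1/2}\binom{n-2k}{u+1-k}^{ -1/2}.$$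
   Context: Posets. $M(n,k_1,\ldots,k_n)=\{(x_1,\ldots,x_n)\in\mathbb{N}^n : 0\le x_i\le k_i \text{ for all } i\}$ (with $0\in\mathbb{N}$), partially ordered componentwise, with rank function $r(x_1,\ldots,x_n)=x_1+\cdots+x_n$. The Boolean algebra is $B(n)=M(n,1,\ldots,1)$ (equivalently, subsets of $\{1,\ldots,n\}$ under inclusion), of rank $n$. For a finite set $S$, $V(S)$ is the complex vector space with basis $S$; the standard inner product on $V(B(n))$ is the one for which $\langle X,Y\rangle=\delta(X,Y)$ (Kronecker delta) for $X,Y\in B(n)$. For a graded poset $P$, $P_i$ is the set of elements of rank $i$, and $v\in V(P)$ is homogeneous of rank $r(v)=i$ if $v\in V(P_i)$. The up operator $U:V(P)\to V(P)$ is the linear map with $U(p)=\sum_q q$, the sum over all $q$ covering $p$. Jordan chains. A graded Jordan chain is a sequence $(v_1,\ldots,v_h)$ of nonzero homogeneous vectors of $V(P)$ with $U(v_{i-1})=v_i$ for $2\le i\le h$ and $U(v_h)=0$; it starts at rank $r(v_1)$ and ends at rank $r(v_h)$. It is symmetric if $r(v_1)+r(v_h)$ equals the rank of $P$. A symmetric Jordan basis (SJB) is a basis of $V(P)$ that is a disjoint union of symmetric Jordan chains. In a chain $(x_k,\ldots,x_{n-k})$ the index denotes the rank. The linear BTK algorithm. Step A (two factors). For integers $p,q\ge 0$ define recursively a collection $\mathcal{J}(p,q)$ of sequences of vectors of $V(M(2,p,q))$. If $p=0$ or $q=0$, then $\mathcal{J}(p,q)$ consists of the single sequence listing the elements of the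 chain $M(2,p,q)$ in increasing order. If $p,q\ge 1$, then $\mathcal{J}(p,q)$ consists of: (1) the sequence $(v(0),v(1),\ldots,v(p+q))$, where $v(k)=\sum\binom{k}{i}(i,j)$, the sum over all $0\le i\le p$, $0\le j\le q$ with $i+j=k$; and (2) for each sequence $(w_1,\ldots,w_h)$ in $\mathcal{J}(p-1,q-1)$, the sequence $(\theta(w_1),\ldots,\theta(w_h))$, where $\theta:V(M(2,p-1,q-1))\to V(M(2,p,q))$ is the linear map with $\theta((i,j))=v(i,j+1)$, and $v(i,j)=(p-i)\,(i,j)-(q-j+1)\,(i+1,j-1)$ for $0\le i\le p-1$, $1\le j\le q$. Step B (general case, recursion on $n$). For $n=1$, $\mathcal{L}(k_1)$ consists of the single sequence $(0,1,\ldots,k_1)$ of elements of $M(1,k_1)$. For $n\ge 2$, let the sequences in $\mathcal{L}(k_1,\ldots,k_{n-1})$ be $(v(0,m),\ldots,v(l_m,m))$, $1\le m\le t$. For $0\le j\le k_n$ let $v(i,j,m)\in V(M(n,k_1,\ldots,k_n))$ be the image of $v(i,m)$ under the linear map with $(a_1,\ldots,a_{n-1})\mapsto(a_1,\ldots,a_{n-1},j)$. For each $m$ let $\psi_m:V(M(2,l_m,k_n))\to V(M(n,k_1,\ldots,k_n))$ be the linear map with $\psi_m((i,j))=v(i,j,m)$. Then $\mathcal{L}(k_1,\ldots,k_n)$ consists of all sequences $(\psi_m(w_1),\ldots,\psi_m(w_h))$ with $1\le m\le t$ and $(w_1,\ldots,w_h)\in\mathcal{J}(l_m,k_n)$. The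 sequences in $\mathcal{L}(k_1,\ldots,k_n)$ are symmetric Jordan chains and together form an SJB of $V(M(n,k_1,\ldots,k_n))$. $O(n)$ denotes this SJB in the case $k_1=\cdots=k_n=1$; "a symmetric Jordan chain in $O(n)$" means one of the sequences in $\mathcal{L}(1,\ldots,1)$ ($n$ ones). -}

module Defs where

open import Algebra.Apartness.Bundles using (HeytingField; HeytingCommutativeRing)
open import Algebra.Bundles using (CommutativeRing; RawRing)
import Algebra.Definitions.RawMonoid as RawMonoidOps
open import Data.Bool using (if_then_else_)
open import Data.Fin using (Fin; zero; suc; toℕ; fromℕ; fromℕ<; inject₁)
import Data.Fin.Properties as Fin
open import Data.List using (List; []; _∷_; map; concatMap; tabulate)
open import Data.List.Membership.Propositional using (_∈_)
open import Data.Nat as ℕ using (ℕ; zero; suc; _∸_; s≤s)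
open import Data.Nat.Combinatorics using (_C_)
import Data.Nat.Properties as ℕ
open import Data.Product using (_×_; _,_; proj₁; proj₂; ∃-syntax)
open import Data.Product.Properties using (≡-dec)
open import Data.Sum using (_⊎_)
open import Data.Unit using (⊤; tt)
open import Data.Vec.Functional as Vector using (Vector)
open import Function using (_∘_)
open import Level using (Level; _⊔_) renaming (suc to lsuc)
open import Relation.Binary.Definitions using (DecidableEquality)
open import Relation.Binary.PropositionalEquality using (_≡_; _≢_; refl; cong; sym; trans; subst)
open import Relation.Binary.Structures using (IsStrictPartialOrder)
open import Relation.Nullary using (¬_; yes; does)

------------------------------------------------------------------------
-- The real numbers, axiomatised as a complete Archimedean ordered field.
--
-- Classically these axioms determine ℝ up to unique isomorphism. They are
-- phrased so that they also hold for the Bishop reals: apartness and < are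
-- positive relations, inverses exist for elements apart from 0, and a
-- Cauchy sequence comes with a modulus.

record RealNumbers c ℓ₁ ℓ₂ ℓ₃ : Set (lsuc (c ⊔ ℓ₁ ⊔ ℓ₂ ⊔ ℓ₃)) where
  field
    heytingField : HeytingField c ℓ₁ ℓ₂

  open HeytingField heytingField public

  commutativeRing : CommutativeRing c ℓ₁
  commutativeRing =
    HeytingCommutativeRing.commutativeRing heytingCommutativeRing

  open RawMonoidOps (CommutativeRing.+-rawMonoid commutativeRing)
    using () renaming (_×_ to _ℕ×_)

  fromNat : ℕ → Carrier
  fromNat n = n ℕ× 1#

  infix 4 _<_ _≤_

  field
    _<_                  : Carrier → Carrier → Set ℓ₃
    isStrictPartialOrder : IsStrictPartialOrder _≈_ _<_
    #⇒<⊎>                : ∀ {x y} → x # y → x < y ⊎ y < x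
    <⇒#                  : ∀ {x y} → x < y → x # y
    +-monoˡ-<            : ∀ {x y} z → x < y → x + z < y + z
    *-pos                : ∀ {x y} → 0# < x → 0# < y → 0# < x * y
    archimedean          : ∀ x → ∃[ n ] x < fromNat n
    complete             : (s : ℕ → Carrier) →
      (∀ ε → 0# < ε →
        ∃[ N ] (∀ m n → N ℕ.≤ m → N ℕ.≤ n → s m < s n + ε)) →
      ∃[ x ] (∀ ε → 0# < ε →
        ∃[ N ] (∀ n → N ℕ.≤ n → (s n < x + ε) × (x < s n + ε)))

  _≤_ : Carrier → Carrier → Set ℓ₃
  x ≤ y = ¬ (y < x)

  -- A total function, whose values are specified only at x ≥ 0, where the
  -- axioms determine it.
  field
    √        : Carrier → Carrier
    √-cong   : ∀ {x y} → x ≈ y → √ x ≈ √ y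
    √-nonneg : ∀ {x} → 0# ≤ x → 0# ≤ √ x
    √-square : ∀ {x} → 0# ≤ x → √ x * √ x ≈ x

  -- #⇒invertible inverts the difference x - 0#.
  inverse : ∀ x → x # 0# → Carrier
  inverse x x#0 = proj₁ (#⇒invertible x#0)

  infixl 7 _/_⟨_⟩
  _/_⟨_⟩ : Carrier → ∀ y → y # 0# → Carrier
  x / y ⟨ y#0 ⟩ = x * inverse y y#0

------------------------------------------------------------------------
-- M(n,k₁,…,kₙ), with tuples nested to the left so that the last coordinate
-- is split off first: (a₁,…,aₙ) is ((a₁,…,aₙ₋₁) , aₙ).

M : (n : ℕ) → Vector ℕ n → Set
M zero          k = ⊤
M (suc zero)    k = Fin (suc (k zero))
M (suc (suc n)) k = M (suc n) (k ∘ inject₁) × Fin (suc (k (fromℕ (suc n))))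

rank : ∀ n k → M n k → ℕ
rank zero          k x       = 0
rank (suc zero)    k x       = toℕ x
rank (suc (suc n)) k (x , j) = rank (suc n) (k ∘ inject₁) x ℕ.+ toℕ j

M-≟ : ∀ n k → DecidableEquality (M n k)
M-≟ zero          k x y = yes refl
M-≟ (suc zero)    k     = Fin._≟_
M-≟ (suc (suc n)) k     = ≡-dec (M-≟ (suc n) (k ∘ inject₁)) Fin._≟_

pair : ℕ → ℕ → Vector ℕ 2
pair p q = p Vector.∷ q Vector.∷ Vector.[]

ones : ∀ n → Vector ℕ n
ones n = Vector.replicate n 1

B : ℕ → Set
B n = M n (ones n)

-- Nonempty finite sequences (a₀,…,aₗ).
Seq : ∀ {a} → Set a → Set a
Seq A = ∃[ l ] Vector A (suc l)

mapSeq : ∀ {a b} {A : Set a} {A′ : Set b} → (A → A′) → Seq A → Seq A′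
mapSeq f (l , v) = l , f ∘ v

------------------------------------------------------------------------
-- The algorithm uses only the ring operations on the scalars.

module LinearBTK {c ℓ} (K : RawRing c ℓ) where

  open RawRing K
  open RawMonoidOps +-rawMonoid using (sum) renaming (_×_ to _ℕ×_)

  V : Set → Set c
  V S = S → Carrier

  fromNat : ℕ → Carrier
  fromNat n = n ℕ× 1#

  infixl 6 _+ᵥ_
  infixl 7 _·ᵥ_

  _+ᵥ_ : ∀ {S} → V S → V S → V S
  (v +ᵥ w) s = v s + w s

  -ᵥ_ : ∀ {S} → V S → V S
  (-ᵥ v) s = - v s

  _·ᵥ_ : ∀ {S} → Carrier → V S → V S
  (a ·ᵥ v) s = a * v s

  sumM : ∀ n k → (M n k → Carrier) → Carrier
  sumM zero          k f = f tt
  sumM (suc zero)    k f = sum f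
  sumM (suc (suc n)) k f =
    sumM (suc n) (k ∘ inject₁) λ x → sum λ j → f (x , j)

  basis : ∀ n k → M n k → V (M n k)
  basis n k x y = if does (M-≟ n k x y) then 1# else 0#

  -- The linear map V(M(n,k)) → V(T) with prescribed values on the basis.
  linear : ∀ n k {T : Set} → (M n k → V T) → V (M n k) → V T
  linear n k f w t = sumM n k λ x → w x * f x t

  Homogeneous : ∀ n k → ℕ → V (M n k) → Set ℓ
  Homogeneous n k r v = ∀ x → rank n k x ≢ r → v x ≈ 0#

  M₂ : ℕ → ℕ → Set
  M₂ p q = M 2 (pair p q)

  basis₂ : ∀ p q → Fin (suc p) → Fin (suc q) → V (M₂ p q)
  basis₂ p q i j = basis 2 (pair p q) (i , j)

  -- v(k) = ∑ (k choose i) (i,j), over i + j = k.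
  vSum : ∀ p q → ℕ → V (M₂ p q)
  vSum p q k (i , j) =
    if does (toℕ i ℕ.+ toℕ j ℕ.≟ k) then fromNat (k C toℕ i) else 0#

  -- θ((i,j)) = v(i,j+1) = (P-i) (i,j+1) - (Q-j) (i+1,j) for P = p+1, Q = q+1;
  -- the second coefficient is Q-(j+1)+1.
  θ : ∀ p q → V (M₂ p q) → V (M₂ (suc p) (suc q))
  θ p q = linear 2 (pair p q) λ (i , j) →
       fromNat (suc p ∸ toℕ i) ·ᵥ basis₂ (suc p) (suc q) (inject₁ i) (suc j)
    +ᵥ -ᵥ (fromNat (suc q ∸ toℕ j) ·ᵥ basis₂ (suc p) (suc q) (suc i) (inject₁ j))

  J : ∀ p q → List (Seq (V (M₂ p q)))
  J zero    q       = (q , λ j → basis₂ 0 q zero j) ∷ []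
  J (suc p) zero    = (suc p , λ i → basis₂ (suc p) 0 i zero) ∷ []
  J (suc p) (suc q) =
    (suc p ℕ.+ suc q , λ k → vSum (suc p) (suc q) (toℕ k))
    ∷ map (mapSeq (θ p q)) (J p q)

  -- Image of w under (a₁,…,aₙ₋₁) ↦ (a₁,…,aₙ₋₁,j).
  extend : ∀ n k → Fin (suc (k (fromℕ (suc n)))) →
           V (M (suc n) (k ∘ inject₁)) → V (M (suc (suc n)) k)
  extend n k j =
    linear (suc n) (k ∘ inject₁) λ a → basis (suc (suc n)) k (a , j)

  ψ : ∀ n k {l} → Vector (V (M (suc n) (k ∘ inject₁))) (suc l) →
      V (M₂ l (k (fromℕ (suc n)))) → V (M (suc (suc n)) k)
  ψ n k {l} v =
    linear 2 (pair l (k (fromℕ (suc n)))) λ (i , j) → extend n k j (v i)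

  -- The recursion starts at n = 1; the clause for n = 0 is a convention.
  L : ∀ n k → List (Seq (V (M n k)))
  L zero          k = (0 , λ _ → basis 0 k tt) ∷ []
  L (suc zero)    k = (k zero , λ i → basis 1 k i) ∷ []
  L (suc (suc n)) k =
    concatMap (λ (l , v) → map (mapSeq (ψ n k v)) (J l (k (fromℕ (suc n)))))
              (L (suc n) (k ∘ inject₁))

------------------------------------------------------------------------

module Complex {c ℓ₁ ℓ₂ ℓ₃} (ℝ : RealNumbers c ℓ₁ ℓ₂ ℓ₃) where

  open RealNumbers ℝ

  infix 5 _+i_

  record ℂ : Set c where
    constructor _+i_
    field
      re im : Carrier

  open ℂ public

  conj : ℂ → ℂ
  conj (a +i b) = a +i (- b)

  rawRing : RawRing c ℓ₁
  rawRing = record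
    { Carrier = ℂ
    ; _≈_     = λ z w → (re z ≈ re w) × (im z ≈ im w)
    ; _+_     = λ z w → (re z + re w) +i (im z + im w)
    ; _*_     = λ z w → (re z * re w - im z * im w) +i (re z * im w + im z * re w)
    ; -_      = λ z → (- re z) +i (- im z)
    ; 0#      = 0# +i 0#
    ; 1#      = 1# +i 0#
    }

------------------------------------------------------------------------

private
  offset< : ∀ n k u → u ℕ.≤ n ∸ k → u ∸ k ℕ.< suc (n ∸ 2 ℕ.* k)
  offset< n k u u≤n-k = s≤s (subst (u ∸ k ℕ.≤_) eq (ℕ.∸-monoˡ-≤ k u≤n-k))
    where
    eq : n ∸ k ∸ k ≡ n ∸ 2 ℕ.* k
    eq = trans (ℕ.∸-+-assoc n k k)
               (cong (λ m → n ∸ (k ℕ.+ m)) (sym (ℕ.+-identityʳ k)))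

module BooleanBTK {c ℓ₁ ℓ₂ ℓ₃} (ℝ : RealNumbers c ℓ₁ ℓ₂ ℓ₃) where

  private module ℝ = RealNumbers ℝ
  open Complex ℝ
  open RawRing rawRing using (_≈_; _*_; 0#)
  open LinearBTK rawRing

  chains : ∀ n → List (Seq (V (B n)))
  chains n = L n (ones n)

  O : ∀ n → List (V (B n))
  O n = concatMap (λ (l , v) → tabulate v) (chains n)

  ⟨_,_⟩ : ∀ {n} → V (B n) → V (B n) → ℂ
  ⟨_,_⟩ {n} v w = sumM n (ones n) λ X → v X * conj (w X)

  Orthogonal : ∀ n → V (B n) → V (B n) → Set ℓ₁
  Orthogonal n v w = ⟨_,_⟩ {n} v w ≈ 0#

  -- ⟨v,v⟩ is real, so its real part is ⟨v,v⟩ itself.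
  norm : ∀ n → V (B n) → ℝ.Carrier
  norm n v = ℝ.√ (re (⟨_,_⟩ {n} v v))

  -- A chain (x_k,…,x_{n-k}) in O(n): it has n - 2k + 1 entries, and the
  -- subscript u, which is the rank, sits at position u - k.
  record SymmetricChain (n k : ℕ) : Set (c ⊔ ℓ₁) where
    field
      vectors  : Vector (V (B n)) (suc (n ∸ 2 ℕ.* k))
      inO      : (n ∸ 2 ℕ.* k , vectors) ∈ chains n
      startsAt : Homogeneous n (ones n) k (vectors zero)
      endsAt   : Homogeneous n (ones n) (n ∸ k) (vectors (fromℕ _))

    at : ∀ u → .(k ℕ.≤ u) → .(u ℕ.≤ n ∸ k) → V (B n)
    at u k≤u u≤n-k = vectors (fromℕ< (offset< n k u u≤n-k))

    normAt : ∀ u → .(k ℕ.≤ u) → .(u ℕ.≤ n ∸ k) → ℝ.Carrier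
    normAt u k≤u u≤n-k = norm n (at u k≤u u≤n-k)

{-# OPTIONS --safe #-}
module Submission where

-- Going from n to n+1, a chain (x₀,…,xₗ) with ‖xᵢ₊₁‖² = (i+1)(l-i)‖xᵢ‖² is
-- replaced by the chain yₖ = xₖ⊗0 + k xₖ₋₁⊗1, of length parameter l+1, and for
-- l ≥ 1 also by zᵢ = (l-i) xᵢ⊗1 - xᵢ₊₁⊗0, of length parameter l-1. If the xᵢ are
-- orthogonal, then so are all the yₖ and zᵢ, the only nontrivial case being
-- ⟨yᵢ₊₁,zᵢ⟩ = (i+1)(l-i)‖xᵢ‖² - ‖xᵢ₊₁‖² = 0, and both new chains satisfy the same
-- recursion for their squared norms, which are positive integers throughout.
-- Everything in the spans of two orthogonal chains remains orthogonal.

open import Defs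
open import Algebra.Bundles using (CommutativeRing; RawRing)
import Algebra.Apartness.Properties.HeytingCommutativeRing as HeytingProperties
import Algebra.Consequences.Setoid as Consequences
open import Algebra.Definitions using (Commutative)
open import Algebra.Morphism.Structures using (module RingMorphisms)
import Algebra.Properties.AbelianGroup as AbelianGroupProperties
import Algebra.Properties.CommutativeMonoid.Sum as CommutativeMonoidSum
import Algebra.Properties.CommutativeSemigroup as CommutativeSemigroupProperties
import Algebra.Properties.Monoid.Mult as MonoidMult
import Algebra.Properties.Ring as RingProperties
import Algebra.Properties.Semiring.Mult as SemiringMult
import Algebra.Properties.Semiring.Sum as SemiringSum
import Algebra.Solver.Ring.NaturalCoefficients.Default as SemiringSolver
open import Algebra.Structures using (IsAbelianGroup)
open import Data.Bool using (if_then_else_)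
open import Data.Fin using (Fin; zero; suc; toℕ; fromℕ<; inject₁)
import Data.Fin.Properties as Fin
open import Data.List using (List; []; _∷_; map; concatMap; tabulate)
open import Data.List.Relation.Unary.All as All using (All; []; _∷_)
import Data.List.Relation.Unary.All.Properties as All
open import Data.List.Relation.Unary.AllPairs as AllPairs using (AllPairs; []; _∷_)
import Data.List.Relation.Unary.AllPairs.Properties as AllPairs
open import Data.Nat as ℕ using (ℕ; zero; suc; _∸_; z≤n; s≤s; NonZero; pred)
open import Data.Nat.Combinatorics
  using (_C_; nCn≡1; nC1≡n; nCk≡nC[n∸k]; k>n⇒nCk≡0; nCk+nC[k+1]≡[n+1]C[k+1])
import Data.Nat.Properties as ℕ
open import Data.Nat.Tactic.RingSolver using (solve-∀)
open import Data.Product using (_×_; _,_; proj₁; proj₂; ∃-syntax; Σ-syntax)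
open import Data.Product.Properties using (,-injectiveˡ; ,-injectiveʳ)
open import Data.Sum using (_⊎_; inj₁; inj₂)
open import Data.Vec.Functional using (Vector)
open import Function using (_∘_)
open import Level using (_⊔_)
open import Relation.Binary.PropositionalEquality as ≡ using (_≡_; _≢_; module ≡-Reasoning)
import Relation.Binary.Reasoning.Setoid as SetoidReasoning
open import Relation.Binary.Structures using (IsStrictPartialOrder)
open import Relation.Nullary using (¬_; yes; no; contradiction)
open import Relation.Nullary.Decidable using (dec-true; dec-false)

-- The splitting is the Clebsch-Gordan rule V(l) ⊗ V(1) = V(l+1) ⊕ V(l-1). With the new bound equal
-- to 1, `J l 1` is the sum sequence together with, for l = p+1, the image under `θ` of the single
-- sequence of `J p 0`. The factor k in yₖ is the binomial coefficient of k over k-1, and the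
-- coefficients of zᵢ are those of `θ`. Orthogonality alone would not survive the induction, since
-- ⟨yᵢ₊₁,zᵢ⟩ = 0 needs the exact norm ratio; both are therefore carried together. The factor
-- (i+1)(l-i) depends on position and length only, never on the initial norm. This gives (ii), and
-- with l = n-2k and i = u-k it is the product (u+1-k)(n-k-u) of (iii). A quotient in ℝ needs a
-- denominator apart from 0, which cannot be obtained by deciding equality of reals. Squared norms
-- are therefore recorded as natural numbers, where being nonzero is decidable, and are transferred
-- to ℝ only at the end. The induction itself runs over a commutative ring with a conjugation; order
-- and roots enter afterwards.

-- Binomial coefficients

-- The absorption rule, by Pascal's rule and induction on n. It turns the root in (iii) into its
-- binomial form.
[1+k]*nC[1+k]≡[n∸k]*nCk : ∀ n k → suc k ℕ.* (n C suc k) ≡ (n ∸ k) ℕ.* (n C k)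
[1+k]*nC[1+k]≡[n∸k]*nCk zero k = begin
  suc k ℕ.* (0 C suc k) ≡⟨ ≡.cong (suc k ℕ.*_) (k>n⇒nCk≡0 {0} {suc k} (s≤s ℕ.z≤n)) ⟩
  suc k ℕ.* 0           ≡⟨ ℕ.*-zeroʳ (suc k) ⟩
  0                     ≡⟨ ≡.cong (ℕ._* (0 C k)) (ℕ.0∸n≡0 k) ⟨
  (0 ∸ k) ℕ.* (0 C k)   ∎
  where open ≡-Reasoning
[1+k]*nC[1+k]≡[n∸k]*nCk (suc n) zero = begin
  1 ℕ.* (suc n C 1)     ≡⟨ ℕ.*-identityˡ _ ⟩
  suc n C 1             ≡⟨ nC1≡n (suc n) ⟩
  suc n                 ≡⟨ ℕ.*-identityʳ (suc n) ⟨
  suc n ℕ.* (suc n C 0) ∎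
  where open ≡-Reasoning
[1+k]*nC[1+k]≡[n∸k]*nCk (suc n) (suc k) = begin
  suc (suc k) ℕ.* (suc n C suc (suc k))
    ≡⟨ ≡.cong (suc (suc k) ℕ.*_) (nCk+nC[k+1]≡[n+1]C[k+1] n (suc k)) ⟨
  suc (suc k) ℕ.* (Y ℕ.+ Z)
    ≡⟨ ℕ.*-distribˡ-+ (suc (suc k)) Y Z ⟩
  suc (suc k) ℕ.* Y ℕ.+ suc (suc k) ℕ.* Z
    ≡⟨ ≡.cong (suc (suc k) ℕ.* Y ℕ.+_) ([1+k]*nC[1+k]≡[n∸k]*nCk n (suc k)) ⟩
  suc (suc k) ℕ.* Y ℕ.+ (n ∸ suc k) ℕ.* Y
    ≡⟨ regroup ⟩
  suc k ℕ.* Y ℕ.+ (n ∸ k) ℕ.* Y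
    ≡⟨ ≡.cong (ℕ._+ (n ∸ k) ℕ.* Y) ([1+k]*nC[1+k]≡[n∸k]*nCk n k) ⟩
  (n ∸ k) ℕ.* X ℕ.+ (n ∸ k) ℕ.* Y
    ≡⟨ ℕ.*-distribˡ-+ (n ∸ k) X Y ⟨
  (n ∸ k) ℕ.* (X ℕ.+ Y)
    ≡⟨ ≡.cong ((n ∸ k) ℕ.*_) (nCk+nC[k+1]≡[n+1]C[k+1] n k) ⟩
  (n ∸ k) ℕ.* (suc n C suc k) ∎
  where
  open ≡-Reasoning
  X = n C k
  Y = n C suc k
  Z = n C suc (suc k)
  -- One copy of `Y` passes to the second summand, which needs n ∸ k = 1 + (n ∸ suc k), hence k < n.
  -- For k ≥ n truncation breaks this, but then `Y` is 0.
  regroup : suc (suc k) ℕ.* Y ℕ.+ (n ∸ suc k) ℕ.* Y ≡ suc k ℕ.* Y ℕ.+ (n ∸ k) ℕ.* Y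
  regroup with k ℕ.<? n
  ... | no k≮n rewrite k>n⇒nCk≡0 {n} {suc k} (s≤s (ℕ.≮⇒≥ k≮n))
    | ℕ.*-zeroʳ (suc k) | ℕ.*-zeroʳ (n ∸ suc k) | ℕ.*-zeroʳ (n ∸ k) = ≡.refl
  ... | yes k<n = begin
    suc (suc k) ℕ.* Y ℕ.+ (n ∸ suc k) ℕ.* Y ≡⟨ ℕ.*-distribʳ-+ Y (suc (suc k)) (n ∸ suc k) ⟨
    (suc (suc k) ℕ.+ (n ∸ suc k)) ℕ.* Y     ≡⟨ ≡.cong (ℕ._* Y) (ℕ.+-suc (suc k) (n ∸ suc k)) ⟨
    (suc k ℕ.+ suc (n ∸ suc k)) ℕ.* Y       ≡⟨ ≡.cong (λ m → (suc k ℕ.+ m) ℕ.* Y) (ℕ.+-∸-assoc 1 k<n) ⟨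
    (suc k ℕ.+ (n ∸ k)) ℕ.* Y               ≡⟨ ℕ.*-distribʳ-+ Y (suc k) (n ∸ k) ⟩
    suc k ℕ.* Y ℕ.+ (n ∸ k) ℕ.* Y           ∎

C-nonZero : ∀ n k → k ℕ.≤ n → NonZero (n C k)
C-nonZero n       zero    _         = _
C-nonZero (suc n) (suc k) (s≤s k≤n) =
  ≡.subst NonZero (nCk+nC[k+1]≡[n+1]C[k+1] n k)
    (ℕ.>-nonZero (ℕ.<-≤-trans (ℕ.>-nonZero⁻¹ (n C k) {{C-nonZero n k k≤n}}) (ℕ.m≤m+n (n C k) (n C suc k))))

1+nCn≡1+n : ∀ n → suc n C n ≡ suc n
1+nCn≡1+n n = begin
  suc n C n           ≡⟨ nCk≡nC[n∸k] (ℕ.n≤1+n n) ⟩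
  suc n C (suc n ∸ n) ≡⟨ ≡.cong (suc n C_) (ℕ.m+n∸n≡m 1 n) ⟩
  suc n C 1           ≡⟨ nC1≡n (suc n) ⟩
  suc n               ∎
  where open ≡-Reasoning

-- Squared norms along a chain, as natural numbers

-- ‖xᵢ‖² in a chain (x₀,…,xₗ) with ‖x₀‖² = c; it is 0 for i > l by truncated
-- subtraction, matching the continuation of the chain by zero.
sqNorm : ℕ → ℕ → ℕ → ℕ
sqNorm l c zero    = c
sqNorm l c (suc i) = suc i ℕ.* (l ∸ i) ℕ.* sqNorm l c i

sqNorm-vanishes : ∀ {l} c {i} → l ℕ.< i → sqNorm l c i ≡ 0
sqNorm-vanishes {l} c {suc i} (s≤s l≤i) = begin
  suc i ℕ.* (l ∸ i) ℕ.* sqNorm l c i ≡⟨ ≡.cong (λ d → suc i ℕ.* d ℕ.* sqNorm l c i) (ℕ.m≤n⇒m∸n≡0 l≤i) ⟩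
  suc i ℕ.* 0 ℕ.* sqNorm l c i       ≡⟨ ≡.cong (ℕ._* sqNorm l c i) (ℕ.*-zeroʳ (suc i)) ⟩
  0                                  ∎
  where open ≡-Reasoning

sqNorm-nonZero : ∀ l c .{{_ : NonZero c}} i → i ℕ.≤ l → NonZero (sqNorm l c i)
sqNorm-nonZero l c zero    i≤l = ℕ.≢-nonZero (ℕ.≢-nonZero⁻¹ c)
sqNorm-nonZero l c (suc i) i<l =
  ℕ.m*n≢0 (suc i ℕ.* (l ∸ i)) _
    {{ℕ.m*n≢0 (suc i) (l ∸ i) {{_}} {{ℕ.>-nonZero (ℕ.m<n⇒0<n∸m i<l)}}}}
    {{sqNorm-nonZero l c i (ℕ.<⇒≤ i<l)}}

-- In closed form `sqNorm l c i` is c i! l! / (l-i)! for i ≤ l, so raising both l and i by one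
-- multiplies it by (i+1)(l+1).
sqNorm-suc-length : ∀ l c k → sqNorm (suc l) c (suc k) ≡ suc k ℕ.* suc l ℕ.* sqNorm l c k
sqNorm-suc-length l c zero    = ≡.refl
sqNorm-suc-length l c (suc k) = begin
  suc (suc k) ℕ.* (l ∸ k) ℕ.* sqNorm (suc l) c (suc k)
    ≡⟨ ≡.cong (suc (suc k) ℕ.* (l ∸ k) ℕ.*_) (sqNorm-suc-length l c k) ⟩
  suc (suc k) ℕ.* (l ∸ k) ℕ.* (suc k ℕ.* suc l ℕ.* sqNorm l c k)
    ≡⟨ rearrange k l (l ∸ k) (sqNorm l c k) ⟩
  suc (suc k) ℕ.* suc l ℕ.* (suc k ℕ.* (l ∸ k) ℕ.* sqNorm l c k) ∎
  where
  open ≡-Reasoning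
  rearrange : ∀ k l d N → suc (suc k) ℕ.* d ℕ.* (suc k ℕ.* suc l ℕ.* N) ≡
                          suc (suc k) ℕ.* suc l ℕ.* (suc k ℕ.* d ℕ.* N)
  rearrange = solve-∀

-- ‖yₖ‖² from its two slices: for k ≥ 1 they contribute k(l-k+1) and k² times ‖xₖ₋₁‖², together
-- k(l+1) times.
sqNorm-upper : ∀ l c k → k ℕ.≤ suc l →
  sqNorm l c k ℕ.+ k ℕ.* k ℕ.* sqNorm l c (pred k) ≡ sqNorm (suc l) c k
sqNorm-upper l c zero    _         = ℕ.+-identityʳ c
sqNorm-upper l c (suc k) (s≤s k≤l) = begin
  suc k ℕ.* (l ∸ k) ℕ.* N ℕ.+ suc k ℕ.* suc k ℕ.* N ≡⟨ factor k (l ∸ k) N ⟩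
  suc k ℕ.* suc (l ∸ k ℕ.+ k) ℕ.* N ≡⟨ ≡.cong (λ m → suc k ℕ.* suc m ℕ.* N) (ℕ.m∸n+n≡m k≤l) ⟩
  suc k ℕ.* suc l ℕ.* N             ≡⟨ sqNorm-suc-length l c k ⟨
  sqNorm (suc l) c (suc k)          ∎
  where
  open ≡-Reasoning
  N = sqNorm l c k
  factor : ∀ k d N → suc k ℕ.* d ℕ.* N ℕ.+ suc k ℕ.* suc k ℕ.* N ≡ suc k ℕ.* suc (d ℕ.+ k) ℕ.* N
  factor = solve-∀

-- ‖z₀‖² for l = p+1 and ‖x₀‖² = c.
lowerStart : ℕ → ℕ → ℕ
lowerStart p c = suc p ℕ.* suc (suc p) ℕ.* c

-- For i ≤ p both sides are c (p+2) i! (p+1)! / (p-i)!.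
sqNorm-pred-length : ∀ p c i →
  sqNorm p (lowerStart p c) i ≡ (suc p ∸ i) ℕ.* suc (suc p) ℕ.* sqNorm (suc p) c i
sqNorm-pred-length p c zero    = ≡.refl
sqNorm-pred-length p c (suc i) = begin
  suc i ℕ.* (p ∸ i) ℕ.* sqNorm p (lowerStart p c) i
    ≡⟨ ≡.cong (suc i ℕ.* (p ∸ i) ℕ.*_) (sqNorm-pred-length p c i) ⟩
  suc i ℕ.* (p ∸ i) ℕ.* ((suc p ∸ i) ℕ.* suc (suc p) ℕ.* sqNorm (suc p) c i)
    ≡⟨ rearrange i p (p ∸ i) (suc p ∸ i) (sqNorm (suc p) c i) ⟩
  (p ∸ i) ℕ.* suc (suc p) ℕ.* (suc i ℕ.* (suc p ∸ i) ℕ.* sqNorm (suc p) c i) ∎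
  where
  open ≡-Reasoning
  rearrange : ∀ i p d e N → suc i ℕ.* d ℕ.* (e ℕ.* suc (suc p) ℕ.* N) ≡
                            d ℕ.* suc (suc p) ℕ.* (suc i ℕ.* e ℕ.* N)
  rearrange = solve-∀

-- ‖zᵢ‖² from its two slices: with l = p+1 they contribute (i+1)(l-i) and (l-i)² times ‖xᵢ‖²,
-- together (l-i)(l+1) times.
sqNorm-lower : ∀ p c i → i ℕ.≤ p →
  sqNorm (suc p) c (suc i) ℕ.+ (suc p ∸ i) ℕ.* (suc p ∸ i) ℕ.* sqNorm (suc p) c i
  ≡ sqNorm p (lowerStart p c) i
sqNorm-lower p c i i≤p = begin
  suc i ℕ.* d ℕ.* N ℕ.+ d ℕ.* d ℕ.* N ≡⟨ factor i d N ⟩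
  d ℕ.* suc (d ℕ.+ i) ℕ.* N           ≡⟨ ≡.cong (λ m → d ℕ.* suc m ℕ.* N) (ℕ.m∸n+n≡m (ℕ.m≤n⇒m≤1+n i≤p)) ⟩
  d ℕ.* suc (suc p) ℕ.* N             ≡⟨ sqNorm-pred-length p c i ⟨
  sqNorm p (lowerStart p c) i         ∎
  where
  open ≡-Reasoning
  d = suc p ∸ i
  N = sqNorm (suc p) c i
  factor : ∀ i d N → suc i ℕ.* d ℕ.* N ℕ.+ d ℕ.* d ℕ.* N ≡ d ℕ.* suc (d ℕ.+ i) ℕ.* N
  factor = solve-∀

-- Sums and coordinates over a commutative ring with conjugation

module HermitianBTK {c ℓ} (K : CommutativeRing c ℓ)
  (conj : CommutativeRing.Carrier K → CommutativeRing.Carrier K)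
  (conj-isHomomorphism : RingMorphisms.IsRingHomomorphism
    (CommutativeRing.rawRing K) (CommutativeRing.rawRing K) conj)
  where

  open CommutativeRing K hiding (zero)
  open LinearBTK rawRing
  open RingMorphisms.IsRingHomomorphism conj-isHomomorphism
    renaming ( ⟦⟧-cong to conj-cong; +-homo to conj-+; *-homo to conj-*
             ; -‿homo to conj-neg; 0#-homo to conj-0#; 1#-homo to conj-1# )
  open RingProperties ring using (-0#≈0#; -1*x≈-x; -‿involutive)
  open CommutativeMonoidSum +-commutativeMonoid using (sum; sum-cong-≋; ∑-distrib-+; sum-replicate-zero)
  open SemiringSum semiring using (*-distribˡ-sum)
  open MonoidMult +-monoid using (×-homo-+)
  open SemiringMult semiring using (×1-homo-*)
  open CommutativeSemigroupProperties *-commutativeSemigroup using (interchange; x∙yz≈y∙xz)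
  open SetoidReasoning setoid

  sum-zero : ∀ {m} (f : Fin m → Carrier) → (∀ i → f i ≈ 0#) → sum f ≈ 0#
  sum-zero {m} f f≈0 = trans (sum-cong-≋ f≈0) (sum-replicate-zero m)

  sum-single : ∀ {m} (f : Fin m → Carrier) i → (∀ j → j ≢ i → f j ≈ 0#) → sum f ≈ f i
  sum-single f zero off =
    trans (+-congˡ (sum-zero (f ∘ suc) λ j → off (suc j) λ ())) (+-identityʳ _)
  sum-single f (suc i) off =
    trans (+-cong (off zero λ ()) (sum-single (f ∘ suc) i λ j j≢i → off (suc j) (j≢i ∘ Fin.suc-injective)))
          (+-identityˡ _)

  sumM-cong : ∀ n k {f g : M n k → Carrier} → (∀ x → f x ≈ g x) → sumM n k f ≈ sumM n k g
  sumM-cong zero          k f≈g = f≈g _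
  sumM-cong (suc zero)    k f≈g = sum-cong-≋ f≈g
  sumM-cong (suc (suc n)) k f≈g =
    sumM-cong (suc n) (k ∘ inject₁) λ x → sum-cong-≋ λ j → f≈g (x , j)

  sumM-single : ∀ n k (f : M n k → Carrier) x → (∀ y → y ≢ x → f y ≈ 0#) → sumM n k f ≈ f x
  sumM-zero   : ∀ n k (f : M n k → Carrier) → (∀ x → f x ≈ 0#) → sumM n k f ≈ 0#

  sumM-single zero          k f x       off = refl
  sumM-single (suc zero)    k f x       off = sum-single f x off
  sumM-single (suc (suc n)) k f (x , j) off = trans
    (sumM-single (suc n) (k ∘ inject₁) _ x λ y y≢x → sum-zero _ λ j′ → off (y , j′) (y≢x ∘ ,-injectiveˡ))
    (sum-single _ j λ j′ j′≢j → off (x , j′) (j′≢j ∘ ,-injectiveʳ))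

  sumM-zero zero          k f f≈0 = f≈0 _
  sumM-zero (suc zero)    k f f≈0 = sum-zero f f≈0
  sumM-zero (suc (suc n)) k f f≈0 =
    sumM-zero (suc n) (k ∘ inject₁) _ λ x → sum-zero _ λ j → f≈0 (x , j)

  sumM-+ : ∀ n k (f g : M n k → Carrier) →
           sumM n k (λ x → f x + g x) ≈ sumM n k f + sumM n k g
  sumM-+ zero          k f g = refl
  sumM-+ (suc zero)    k f g = ∑-distrib-+ f g
  sumM-+ (suc (suc n)) k f g = trans
    (sumM-cong (suc n) (k ∘ inject₁) λ x → ∑-distrib-+ (λ j → f (x , j)) (λ j → g (x , j)))
    (sumM-+ (suc n) (k ∘ inject₁) _ _)

  *-distribˡ-sumM : ∀ n k a (f : M n k → Carrier) → a * sumM n k f ≈ sumM n k (λ x → a * f x)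
  *-distribˡ-sumM zero          k a f = refl
  *-distribˡ-sumM (suc zero)    k a f = *-distribˡ-sum a f
  *-distribˡ-sumM (suc (suc n)) k a f = trans
    (*-distribˡ-sumM (suc n) (k ∘ inject₁) a _)
    (sumM-cong (suc n) (k ∘ inject₁) λ x → *-distribˡ-sum a λ j → f (x , j))

  basis-diagonal : ∀ n k x → basis n k x x ≈ 1#
  basis-diagonal n k x with M-≟ n k x x
  ... | yes _  = refl
  ... | no x≢x = contradiction ≡.refl x≢x

  basis-off-diagonal : ∀ n k {x y} → x ≢ y → basis n k x y ≈ 0#
  basis-off-diagonal n k {x} {y} x≢y with M-≟ n k x y
  ... | yes x≡y = contradiction x≡y x≢y
  ... | no _    = refl

  linear-basis : ∀ n k {T : Set} (f : M n k → V T) x t → linear n k f (basis n k x) t ≈ f x t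
  linear-basis n k f x t = begin
    sumM n k (λ y → basis n k x y * f y t)
      ≈⟨ sumM-single n k _ x (λ y y≢x → trans (*-congʳ (basis-off-diagonal n k (y≢x ∘ ≡.sym))) (zeroˡ _)) ⟩
    basis n k x x * f x t ≈⟨ *-congʳ (basis-diagonal n k x) ⟩
    1# * f x t            ≈⟨ *-identityˡ _ ⟩
    f x t                 ∎

  extend-same : ∀ n k j u x → extend n k j u (x , j) ≈ u x
  extend-same n k j u x = begin
    extend n k j u (x , j)
      ≈⟨ sumM-single (suc n) (k ∘ inject₁) _ x (λ a a≢x →
           trans (*-congˡ (basis-off-diagonal (suc (suc n)) k (a≢x ∘ ,-injectiveˡ))) (zeroʳ _)) ⟩
    u x * basis (suc (suc n)) k (x , j) (x , j) ≈⟨ *-congˡ (basis-diagonal (suc (suc n)) k (x , j)) ⟩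
    u x * 1#                                    ≈⟨ *-identityʳ _ ⟩
    u x                                         ∎

  extend-other : ∀ n k {i j} u x → i ≢ j → extend n k i u (x , j) ≈ 0#
  extend-other n k u x i≢j = sumM-zero (suc n) (k ∘ inject₁) _ λ a →
    trans (*-congˡ (basis-off-diagonal (suc (suc n)) k (i≢j ∘ ,-injectiveʳ))) (zeroʳ _)

  -- The image of `extend` at j is supported on last coordinate j, so on that slice only column j of
  -- w contributes. All later arguments see `ψ` through this formula alone.
  ψ-apply : ∀ n k {l} (v : Vector (V (M (suc n) (k ∘ inject₁))) (suc l)) w x j →
            ψ n k v w (x , j) ≈ sum λ i → w (i , j) * v i x
  ψ-apply n k v w x j = sum-cong-≋ λ i → trans
    (sum-single _ j λ j′ j′≢j → trans (*-congˡ (extend-other n k (v i) x j′≢j)) (zeroʳ (w (i , j′))))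
    (*-congˡ (extend-same n k j (v i) x))

  -- The chain continued by zero, in accordance with U(xₗ) = 0. The last upper vector yₗ₊₁ refers to
  -- xₗ₊₁ and so needs no separate case.
  term : ∀ {S : Set} {m} → Vector (V S) m → ℕ → V S
  term {m = zero}  v i       = λ _ → 0#
  term {m = suc m} v zero    = v zero
  term {m = suc m} v (suc i) = term (v ∘ suc) i

  term-view : ∀ {S : Set} {m} (v : Vector (V S) m) i →
              (∃[ j ] toℕ j ≡ i × term v i ≡ v j) ⊎ (m ℕ.≤ i × term v i ≡ λ _ → 0#)
  term-view {m = zero}  v i    = inj₂ (z≤n , ≡.refl)
  term-view {m = suc m} v zero = inj₁ (zero , ≡.refl , ≡.refl)
  term-view {m = suc m} v (suc i) with term-view (v ∘ suc) i
  ... | inj₁ (j , j≡i , eq) = inj₁ (suc j , ≡.cong suc j≡i , eq)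
  ... | inj₂ (m≤i , eq)     = inj₂ (s≤s m≤i , eq)

  -- The position k may lie beyond the end of v: then no index matches, the sum is 0, and so is
  -- `term v k`.
  sum-single-term : ∀ {S : Set} {m} (a : Fin m → Carrier) (v : Vector (V S) m) k α x →
    (∀ i → toℕ i ≡ k → a i ≈ α) → (∀ i → toℕ i ≢ k → a i ≈ 0#) →
    sum (λ i → a i * v i x) ≈ α * term v k x
  sum-single-term {m = zero}  a v k       α x on off = sym (zeroʳ α)
  sum-single-term {m = suc m} a v zero    α x on off = trans
    (sum-single (λ i → a i * v i x) zero λ where
      zero    0≢0 → contradiction ≡.refl 0≢0
      (suc j) _   → trans (*-congʳ (off (suc j) λ ())) (zeroˡ _))
    (*-congʳ (on zero ≡.refl))
  sum-single-term {m = suc m} a v (suc k) α x on off = begin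
    a zero * v zero x + sum (λ i → a (suc i) * v (suc i) x)
      ≈⟨ +-cong (trans (*-congʳ (off zero λ ())) (zeroˡ _))
           (sum-single-term (a ∘ suc) (v ∘ suc) k α x
             (λ i i≡k → on (suc i) (≡.cong suc i≡k))
             (λ i i≢k → off (suc i) (i≢k ∘ ℕ.suc-injective))) ⟩
    0# + α * term (v ∘ suc) k x ≈⟨ +-identityˡ _ ⟩
    α * term (v ∘ suc) k x      ∎

  -- The inner product and orthogonal spans

  -- Over ℂ with complex conjugation this unfolds to the standard inner product of the theorem, so
  -- that results carry over without transport.
  ⟪_,_⟫ : ∀ {n} → V (B n) → V (B n) → Carrier
  ⟪_,_⟫ {n} v w = sumM n (ones n) λ X → v X * conj (w X)

  ⟪⟫-cong : ∀ n {v v′ w w′ : V (B n)} → (∀ X → v X ≈ v′ X) → (∀ X → w X ≈ w′ X) →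
            ⟪_,_⟫ {n} v w ≈ ⟪_,_⟫ {n} v′ w′
  ⟪⟫-cong n v≈v′ w≈w′ = sumM-cong n (ones n) λ X → *-cong (v≈v′ X) (conj-cong (w≈w′ X))

  ⟪⟫-zeroˡ : ∀ n (w : V (B n)) → ⟪_,_⟫ {n} (λ _ → 0#) w ≈ 0#
  ⟪⟫-zeroˡ n w = sumM-zero n (ones n) _ λ X → zeroˡ _

  ⟪⟫-zeroʳ : ∀ n (v : V (B n)) → ⟪_,_⟫ {n} v (λ _ → 0#) ≈ 0#
  ⟪⟫-zeroʳ n v = sumM-zero n (ones n) _ λ X → trans (*-congˡ conj-0#) (zeroʳ _)

  ⟪⟫-scale : ∀ n a b (v w : V (B n)) → conj b ≈ b →
             ⟪_,_⟫ {n} (a ·ᵥ v) (b ·ᵥ w) ≈ a * b * ⟪_,_⟫ {n} v w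
  ⟪⟫-scale n a b v w b̄≈b = begin
    ⟪_,_⟫ {n} (a ·ᵥ v) (b ·ᵥ w)
      ≈⟨ sumM-cong n (ones n) (λ X → trans
           (*-congˡ (trans (conj-* b (w X)) (*-congʳ b̄≈b))) (interchange a (v X) b (conj (w X)))) ⟩
    sumM n (ones n) (λ X → a * b * (v X * conj (w X)))
      ≈⟨ *-distribˡ-sumM n (ones n) (a * b) _ ⟨
    a * b * ⟪_,_⟫ {n} v w ∎

  ⟪⟫-sum-vanishesˡ : ∀ n {m} (a : Fin m → Carrier) (v : Vector (V (B n)) m) (w : V (B n)) →
    (∀ i → ⟪_,_⟫ {n} (v i) w ≈ 0#) → ⟪_,_⟫ {n} (λ X → sum λ i → a i * v i X) w ≈ 0#
  ⟪⟫-sum-vanishesˡ n {zero}  a v w v⊥w = ⟪⟫-zeroˡ n w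
  ⟪⟫-sum-vanishesˡ n {suc m} a v w v⊥w = begin
    ⟪_,_⟫ {n} (λ X → a zero * v zero X + sum λ i → a (suc i) * v (suc i) X) w
      ≈⟨ trans (sumM-cong n (ones n) λ X → trans (distribʳ _ _ _) (+-congʳ (*-assoc _ _ _)))
               (sumM-+ n (ones n) _ _) ⟩
    sumM n (ones n) (λ X → a zero * (v zero X * conj (w X)))
      + ⟪_,_⟫ {n} (λ X → sum λ i → a (suc i) * v (suc i) X) w
      ≈⟨ +-cong (trans (sym (*-distribˡ-sumM n (ones n) (a zero) _))
                       (trans (*-congˡ (v⊥w zero)) (zeroʳ _)))
                (⟪⟫-sum-vanishesˡ n (a ∘ suc) (v ∘ suc) w (v⊥w ∘ suc)) ⟩
    0# + 0# ≈⟨ +-identityˡ _ ⟩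
    0#      ∎

  ⟪⟫-sum-vanishesʳ : ∀ n {m} (a : Fin m → Carrier) (v : V (B n)) (w : Vector (V (B n)) m) →
    (∀ i → ⟪_,_⟫ {n} v (w i) ≈ 0#) → ⟪_,_⟫ {n} v (λ X → sum λ i → a i * w i X) ≈ 0#
  ⟪⟫-sum-vanishesʳ n {zero}  a v w v⊥w = ⟪⟫-zeroʳ n v
  ⟪⟫-sum-vanishesʳ n {suc m} a v w v⊥w = begin
    ⟪_,_⟫ {n} v (λ X → a zero * w zero X + sum λ i → a (suc i) * w (suc i) X)
      ≈⟨ trans (sumM-cong n (ones n) λ X → trans
                  (*-congˡ (trans (conj-+ _ _) (+-congʳ (conj-* _ _))))
                  (trans (distribˡ _ _ _) (+-congʳ (x∙yz≈y∙xz _ _ _))))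
               (sumM-+ n (ones n) _ _) ⟩
    sumM n (ones n) (λ X → conj (a zero) * (v X * conj (w zero X)))
      + ⟪_,_⟫ {n} v (λ X → sum λ i → a (suc i) * w (suc i) X)
      ≈⟨ +-cong (trans (sym (*-distribˡ-sumM n (ones n) (conj (a zero)) _))
                       (trans (*-congˡ (v⊥w zero)) (zeroʳ _)))
                (⟪⟫-sum-vanishesʳ n (a ∘ suc) v (w ∘ suc) (v⊥w ∘ suc)) ⟩
    0# + 0# ≈⟨ +-identityˡ _ ⟩
    0#      ∎

  -- The last coordinate takes two values, which makes the space an orthogonal sum of two copies of
  -- the previous one.
  ⟪⟫-slices : ∀ n (u w : V (B (suc (suc n)))) →
    ⟪_,_⟫ {suc (suc n)} u w ≈
    ⟪_,_⟫ {suc n} (λ x → u (x , zero)) (λ x → w (x , zero)) +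
    ⟪_,_⟫ {suc n} (λ x → u (x , suc zero)) (λ x → w (x , suc zero))
  ⟪⟫-slices n u w = trans
    (sumM-cong (suc n) (ones (suc n)) λ x → +-congˡ (+-identityʳ _))
    (sumM-+ (suc n) (ones (suc n)) _ _)

  Cross : ∀ n → Seq (V (B n)) → Seq (V (B n)) → Set ℓ
  Cross n (l , v) (m , w) = ∀ i j → ⟪_,_⟫ {n} (v i) (w j) ≈ 0#

  -- Each slice of `ψ n k v w` is a combination of the vectors of v, so w and w′ may be arbitrary.
  ψ-cross : ∀ n {l m} (v : Vector (V (B (suc n))) (suc l)) (v′ : Vector (V (B (suc n))) (suc m)) →
    Cross (suc n) (l , v) (m , v′) → ∀ w w′ →
    ⟪_,_⟫ {suc (suc n)} (ψ n (ones (suc (suc n))) v w) (ψ n (ones (suc (suc n))) v′ w′) ≈ 0#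
  ψ-cross n v v′ v⊥v′ w w′ =
    trans (⟪⟫-slices n (ψ n k v w) (ψ n k v′ w′)) (trans (+-cong (vanishes zero) (vanishes (suc zero))) (+-identityˡ _))
    where
    k = ones (suc (suc n))
    vanishes : ∀ j → ⟪_,_⟫ {suc n} (λ x → ψ n k v w (x , j)) (λ x → ψ n k v′ w′ (x , j)) ≈ 0#
    vanishes j = trans
      (⟪⟫-cong (suc n) (λ x → ψ-apply n k v w x j) (λ x → ψ-apply n k v′ w′ x j))
      (⟪⟫-sum-vanishesˡ (suc n) (λ i → w (i , j)) v _ λ i →
        ⟪⟫-sum-vanishesʳ (suc n) (λ i′ → w′ (i′ , j)) (v i) v′ λ i′ → v⊥v′ i i′)

  -- Gram matrices of the new chains

  fromNat-+ : ∀ a b → fromNat (a ℕ.+ b) ≈ fromNat a + fromNat b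
  fromNat-+ = ×-homo-+ 1#

  fromNat-* : ∀ a b → fromNat (a ℕ.* b) ≈ fromNat a * fromNat b
  fromNat-* = ×1-homo-*

  fromNat-1 : fromNat 1 ≈ 1#
  fromNat-1 = +-identityʳ 1#

  conj-fromNat : ∀ a → conj (fromNat a) ≈ fromNat a
  conj-fromNat zero    = conj-0#
  conj-fromNat (suc a) = trans (conj-+ _ _) (+-cong conj-1# (conj-fromNat a))

  conj--1# : conj (- 1#) ≈ - 1#
  conj--1# = trans (conj-neg 1#) (-‿cong conj-1#)

  -- u = α a⊗0 + β b⊗1.
  record Slices n (α : Carrier) (a : V (B (suc n))) (β : Carrier) (b : V (B (suc n)))
                (u : V (B (suc (suc n)))) : Set (c ⊔ ℓ) where
    field
      slice₀ : ∀ x → u (x , zero) ≈ α * a x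
      slice₁ : ∀ x → u (x , suc zero) ≈ β * b x

  open Slices

  ⟪⟫-Slices : ∀ n {α a β b u α′ a′ β′ b′ u′} →
    Slices n α a β b u → Slices n α′ a′ β′ b′ u′ → conj α′ ≈ α′ → conj β′ ≈ β′ →
    ⟪_,_⟫ {suc (suc n)} u u′ ≈
    α * α′ * ⟪_,_⟫ {suc n} a a′ + β * β′ * ⟪_,_⟫ {suc n} b b′
  ⟪⟫-Slices n {u = u} {u′ = u′} s s′ ᾱ≈α β̄≈β = trans (⟪⟫-slices n u u′) (+-cong
    (trans (⟪⟫-cong (suc n) (slice₀ s) (slice₀ s′)) (⟪⟫-scale (suc n) _ _ _ _ ᾱ≈α))
    (trans (⟪⟫-cong (suc n) (slice₁ s) (slice₁ s′)) (⟪⟫-scale (suc n) _ _ _ _ β̄≈β)))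

  -- The invariant of the induction: a diagonal Gram matrix whose entries are integers determined by
  -- the length of the chain and c.
  record Gram n (s : Seq (V (B n))) (c : ℕ) : Set ℓ where
    field
      orthogonal : ∀ {i j} → i ≢ j → ⟪_,_⟫ {n} (proj₂ s i) (proj₂ s j) ≈ 0#
      normSq     : ∀ i → ⟪_,_⟫ {n} (proj₂ s i) (proj₂ s i) ≈ fromNat (sqNorm (proj₁ s) c (toℕ i))

  module _ n {l} {v : Vector (V (B n)) (suc l)} {c} (G : Gram n (l , v) c) where
    open Gram G

    term-orthogonal : ∀ {i j} → i ≢ j → ⟪_,_⟫ {n} (term v i) (term v j) ≈ 0#
    term-orthogonal {i} {j} i≢j with term-view v i | term-view v j
    ... | inj₂ (_ , eq) | _ rewrite eq = ⟪⟫-zeroˡ n (term v j)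
    ... | inj₁ _ | inj₂ (_ , eq) rewrite eq = ⟪⟫-zeroʳ n (term v i)
    ... | inj₁ (i′ , ≡.refl , eq) | inj₁ (j′ , ≡.refl , eq′) rewrite eq | eq′ =
      orthogonal (i≢j ∘ ≡.cong toℕ)

    term-normSq : ∀ i → ⟪_,_⟫ {n} (term v i) (term v i) ≈ fromNat (sqNorm l c i)
    term-normSq i with term-view v i
    ... | inj₁ (i′ , ≡.refl , eq) rewrite eq = normSq i′
    ... | inj₂ (l<i , eq) rewrite eq | sqNorm-vanishes c l<i = ⟪⟫-zeroˡ n (λ _ → 0#)

  -- Upper characterises yₖ and Lower characterises zᵢ.
  Upper : ∀ n {l} → Vector (V (B (suc n))) (suc l) → ℕ → V (B (suc (suc n))) → Set (c ⊔ ℓ)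
  Upper n v k = Slices n 1# (term v k) (fromNat k) (term v (pred k))

  Lower : ∀ n {p} → Vector (V (B (suc n))) (suc (suc p)) → ℕ → V (B (suc (suc n))) → Set (c ⊔ ℓ)
  Lower n {p} v i = Slices n (- 1#) (term v (suc i)) (fromNat (suc p ∸ i)) (term v i)

  +-vanishes : ∀ {a b} → a ≈ 0# → b ≈ 0# → a + b ≈ 0#
  +-vanishes a≈0 b≈0 = trans (+-cong a≈0 b≈0) (+-identityˡ 0#)

  *-vanishesʳ : ∀ a {b} → b ≈ 0# → a * b ≈ 0#
  *-vanishesʳ a b≈0 = trans (*-congˡ b≈0) (zeroʳ a)

  -- Serves both norm computations: α is the square of the coefficient 1 in yₖ or of -1 in zᵢ, and m
  -- is the other coefficient.
  fromNat-combine : ∀ {α a b} N m M → α ≈ 1# → a ≈ fromNat N → b ≈ fromNat M →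
    α * a + fromNat m * fromNat m * b ≈ fromNat (N ℕ.+ m ℕ.* m ℕ.* M)
  fromNat-combine {α} {a} {b} N m M α≈1 a≈N b≈M = begin
    α * a + fromNat m * fromNat m * b
      ≈⟨ +-cong (trans (*-cong α≈1 a≈N) (*-identityˡ _)) (*-cong (sym (fromNat-* m m)) b≈M) ⟩
    fromNat N + fromNat (m ℕ.* m) * fromNat M ≈⟨ +-congˡ (fromNat-* (m ℕ.* m) M) ⟨
    fromNat N + fromNat (m ℕ.* m ℕ.* M)       ≈⟨ fromNat-+ N _ ⟨
    fromNat (N ℕ.+ m ℕ.* m ℕ.* M)             ∎

  -1*-1≈1 : - 1# * - 1# ≈ 1#
  -1*-1≈1 = trans (-1*x≈-x (- 1#)) (-‿involutive 1#)

  module UpperStep n {l} {v : Vector (V (B (suc n))) (suc l)} {c} (G : Gram (suc n) (l , v) c) where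

    upper-orthogonal : ∀ {k k′ u u′} → Upper n v k u → Upper n v k′ u′ → k ≢ k′ →
                       ⟪_,_⟫ {suc (suc n)} u u′ ≈ 0#
    upper-orthogonal {k} {k′} s s′ k≢k′ = trans
      (⟪⟫-Slices n s s′ conj-1# (conj-fromNat k′))
      (+-vanishes (*-vanishesʳ _ (term-orthogonal (suc n) G k≢k′)) (coefficients k k′ k≢k′))
      where
      coefficients : ∀ k k′ → k ≢ k′ →
        fromNat k * fromNat k′ * ⟪_,_⟫ {suc n} (term v (pred k)) (term v (pred k′)) ≈ 0#
      -- `pred` identifies 0 and 1, so the two terms may coincide here; the coefficient `fromNat 0`
      -- removes them.
      coefficients zero    k′       _    = trans (*-congʳ (zeroˡ _)) (zeroˡ _)
      coefficients (suc k) zero     _    = trans (*-congʳ (zeroʳ _)) (zeroˡ _)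
      coefficients (suc k) (suc k′) k≢k′ = *-vanishesʳ _ (term-orthogonal (suc n) G (k≢k′ ∘ ≡.cong suc))

    upper-normSq : ∀ {k u} → Upper n v k u → k ℕ.≤ suc l →
                   ⟪_,_⟫ {suc (suc n)} u u ≈ fromNat (sqNorm (suc l) c k)
    upper-normSq {k} {u} s k≤1+l = begin
      ⟪_,_⟫ {suc (suc n)} u u ≈⟨ ⟪⟫-Slices n s s conj-1# (conj-fromNat k) ⟩
      _ ≈⟨ fromNat-combine (sqNorm l c k) k (sqNorm l c (pred k)) (*-identityˡ 1#)
           (term-normSq (suc n) G k) (term-normSq (suc n) G (pred k)) ⟩
      fromNat (sqNorm l c k ℕ.+ k ℕ.* k ℕ.* sqNorm l c (pred k)) ≡⟨ ≡.cong fromNat (sqNorm-upper l c k k≤1+l) ⟩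
      fromNat (sqNorm (suc l) c k) ∎

    -- The length is given up to an equation because `J` produces it as `suc p + 1`, which does not
    -- reduce to `suc (suc p)`.
    upper-Gram : ∀ {m} {u : Vector (V (B (suc (suc n)))) (suc m)} → m ≡ suc l →
                 (∀ k → Upper n v (toℕ k) (u k)) → Gram (suc (suc n)) (m , u) c
    upper-Gram ≡.refl s = record
      { orthogonal = λ {i} {j} i≢j → upper-orthogonal (s i) (s j) (i≢j ∘ Fin.toℕ-injective)
      ; normSq     = λ i → upper-normSq (s i) (Fin.toℕ≤pred[n] i)
      }

  module LowerStep n {p} {v : Vector (V (B (suc n))) (suc (suc p))} {c} (G : Gram (suc n) (suc p , v) c) where

    lower-orthogonal : ∀ {i i′ u u′} → Lower n v i u → Lower n v i′ u′ → i ≢ i′ →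
                       ⟪_,_⟫ {suc (suc n)} u u′ ≈ 0#
    lower-orthogonal {i} {i′} s s′ i≢i′ = trans
      (⟪⟫-Slices n s s′ conj--1# (conj-fromNat (suc p ∸ i′)))
      (+-vanishes (*-vanishesʳ _ (term-orthogonal (suc n) G (i≢i′ ∘ ℕ.suc-injective)))
           (*-vanishesʳ _ (term-orthogonal (suc n) G i≢i′)))

    lower-normSq : ∀ {i u} → Lower n v i u → i ℕ.≤ p →
                   ⟪_,_⟫ {suc (suc n)} u u ≈ fromNat (sqNorm p (lowerStart p c) i)
    lower-normSq {i} {u} s i≤p = begin
      ⟪_,_⟫ {suc (suc n)} u u ≈⟨ ⟪⟫-Slices n s s conj--1# (conj-fromNat (suc p ∸ i)) ⟩
      _ ≈⟨ fromNat-combine (sqNorm (suc p) c (suc i)) (suc p ∸ i) (sqNorm (suc p) c i) -1*-1≈1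
           (term-normSq (suc n) G (suc i)) (term-normSq (suc n) G i) ⟩
      fromNat (sqNorm (suc p) c (suc i) ℕ.+ (suc p ∸ i) ℕ.* (suc p ∸ i) ℕ.* sqNorm (suc p) c i)
        ≡⟨ ≡.cong fromNat (sqNorm-lower p c i i≤p) ⟩
      fromNat (sqNorm p (lowerStart p c) i) ∎

    lower-Gram : {u : Vector (V (B (suc (suc n)))) (suc p)} →
                 (∀ i → Lower n v (toℕ i) (u i)) → Gram (suc (suc n)) (p , u) (lowerStart p c)
    lower-Gram s = record
      { orthogonal = λ {i} {j} i≢j → lower-orthogonal (s i) (s j) (i≢j ∘ Fin.toℕ-injective)
      ; normSq     = λ i → lower-normSq (s i) (Fin.toℕ≤pred[n] i)
      }

    upper-lower-orthogonal : ∀ {k i u u′} → Upper n v k u → Lower n v i u′ →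
                             ⟪_,_⟫ {suc (suc n)} u u′ ≈ 0#
    upper-lower-orthogonal {k} {i} s s′ = trans
      (⟪⟫-Slices n s s′ conj--1# (conj-fromNat (suc p ∸ i))) (cancel k)
      where
      d = suc p ∸ i
      cancel : ∀ k →
        1# * - 1# * ⟪_,_⟫ {suc n} (term v k) (term v (suc i)) +
        fromNat k * fromNat d * ⟪_,_⟫ {suc n} (term v (pred k)) (term v i) ≈ 0#
      cancel k with k ℕ.≟ suc i
      -- `sqNorm (suc p) c (suc i)` unfolds to suc i * d * N, so the two summands are opposite.
      ... | yes ≡.refl = begin
        1# * - 1# * ⟪_,_⟫ {suc n} (term v (suc i)) (term v (suc i)) +
        fromNat (suc i) * fromNat d * ⟪_,_⟫ {suc n} (term v i) (term v i)
          ≈⟨ +-cong (*-cong (*-identityˡ _) (term-normSq (suc n) G (suc i)))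
                    (*-cong (sym (fromNat-* (suc i) d)) (term-normSq (suc n) G i)) ⟩
        - 1# * fromNat (suc i ℕ.* d ℕ.* N) + fromNat (suc i ℕ.* d) * fromNat N
          ≈⟨ +-cong (-1*x≈-x _) (sym (fromNat-* (suc i ℕ.* d) N)) ⟩
        - fromNat (suc i ℕ.* d ℕ.* N) + fromNat (suc i ℕ.* d ℕ.* N)
          ≈⟨ -‿inverseˡ _ ⟩
        0# ∎
        where N = sqNorm (suc p) c i
      -- For i = 0 the second product is ‖x₀‖², again because `pred 0` is 0; its coefficient
      -- `fromNat 0` vanishes.
      cancel zero | no k≢1+i =
        +-vanishes (*-vanishesʳ _ (term-orthogonal (suc n) G k≢1+i)) (trans (*-congʳ (zeroˡ _)) (zeroˡ _))
      cancel (suc k) | no k≢1+i =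
        +-vanishes (*-vanishesʳ _ (term-orthogonal (suc n) G k≢1+i))
            (*-vanishesʳ _ (term-orthogonal (suc n) G (k≢1+i ∘ ≡.cong suc)))

  -- The sequences of `J l 1` in coordinates

  vSum-on : ∀ p q k i j → toℕ i ℕ.+ toℕ j ≡ k → vSum p q k (i , j) ≡ fromNat (k C toℕ i)
  vSum-on p q k i j i+j≡k =
    ≡.cong (if_then fromNat (k C toℕ i) else 0#) (dec-true (toℕ i ℕ.+ toℕ j ℕ.≟ k) i+j≡k)

  vSum-off : ∀ p q k i j → toℕ i ℕ.+ toℕ j ≢ k → vSum p q k (i , j) ≡ 0#
  vSum-off p q k i j i+j≢k =
    ≡.cong (if_then fromNat (k C toℕ i) else 0#) (dec-false (toℕ i ℕ.+ toℕ j ℕ.≟ k) i+j≢k)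

  -- Column 0 of the sum has only the entry at i = k, with coefficient 1, and column 1 only the one
  -- at i = k-1, with coefficient k. Pointwise agreement of w with the sum suffices, so the case l =
  -- 0, where `J` lists basis vectors, is covered too.
  vSum-Upper : ∀ n {l} (v : Vector (V (B (suc n))) (suc l)) k w →
    (∀ i j → w (i , j) ≈ vSum l 1 k (i , j)) → Upper n v k (ψ n (ones (suc (suc n))) v w)
  vSum-Upper n {l} v k w w≈vSum = record
    { slice₀ = λ x → trans (ψ-apply n _ v w x zero)
        (sum-single-term _ v k 1# x
          (λ i i≡k → begin
            w (i , zero)        ≈⟨ w≈vSum i zero ⟩
            vSum l 1 k (i , zero) ≡⟨ vSum-on l 1 k i zero (≡.trans (ℕ.+-identityʳ _) i≡k) ⟩
            fromNat (k C toℕ i) ≡⟨ ≡.cong fromNat (≡.trans (≡.cong (k C_) i≡k) (nCn≡1 k)) ⟩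
            fromNat 1           ≈⟨ fromNat-1 ⟩
            1#                  ∎)
          (λ i i≢k → trans (w≈vSum i zero)
            (reflexive (vSum-off l 1 k i zero (i≢k ∘ ≡.trans (≡.sym (ℕ.+-identityʳ _)))))))
    ; slice₁ = λ x → trans (ψ-apply n _ v w x (suc zero))
        (sum-single-term _ v (pred k) (fromNat k) x
          (λ i i≡k-1 → trans (w≈vSum i (suc zero)) (reflexive (on k i i≡k-1)))
          (λ i i≢k-1 → trans (w≈vSum i (suc zero))
            (reflexive (vSum-off l 1 k i (suc zero) (i≢k-1 ∘ λ i+1≡k →
              ≡.trans (≡.cong pred (ℕ.+-comm 1 (toℕ i))) (≡.cong pred i+1≡k))))))
    }
    where
    on : ∀ k i → toℕ i ≡ pred k → vSum l 1 k (i , suc zero) ≡ fromNat k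
    -- For k = 0 the position `pred 0` is a genuine index, but (0,1) has rank 1; its coefficient 0
    -- is `fromNat 0`.
    on zero    i _   = vSum-off l 1 0 i (suc zero) (ℕ.m+1+n≢0 (toℕ i))
    on (suc k) i ≡.refl = ≡.trans
      (vSum-on l 1 (suc k) i (suc zero) (ℕ.+-comm (toℕ i) 1))
      (≡.cong fromNat (1+nCn≡1+n (toℕ i)))

  -- M(2,0,1) has one element of each rank, and its coefficient is k over 0, that is 1.
  basis₂-vSum : ∀ (k j : Fin 2) → basis₂ 0 1 zero k (zero , j) ≈ vSum 0 1 (toℕ k) (zero , j)
  basis₂-vSum zero       zero       = sym fromNat-1
  basis₂-vSum zero       (suc zero) = refl
  basis₂-vSum (suc zero) zero       = refl
  basis₂-vSum (suc zero) (suc zero) = sym fromNat-1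

  basis₂-same : ∀ p q {i i′} j → toℕ i ≡ toℕ i′ → basis₂ p q i j (i′ , j) ≈ 1#
  basis₂-same p q {i} j i≡i′ with Fin.toℕ-injective i≡i′
  ... | ≡.refl = basis-diagonal 2 (pair p q) (i , j)

  basis₂-≢ˡ : ∀ p q {i i′} j j′ → toℕ i ≢ toℕ i′ → basis₂ p q i j (i′ , j′) ≈ 0#
  basis₂-≢ˡ p q {i} {i′} j j′ i≢i′ =
    basis-off-diagonal 2 (pair p q) {i , j} {i′ , j′} (i≢i′ ∘ ≡.cong toℕ ∘ ,-injectiveˡ)

  basis₂-≢ʳ : ∀ p q i i′ {j j′} → j ≢ j′ → basis₂ p q i j (i′ , j′) ≈ 0#
  basis₂-≢ʳ p q i i′ {j} {j′} j≢j′ =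
    basis-off-diagonal 2 (pair p q) {i , j} {i′ , j′} (j≢j′ ∘ ,-injectiveʳ)

  -- With second bound 1, θ((i,0)) = (p+1-i)(i,1) - (i+1,0); its two columns are the two slices.
  θ-Lower : ∀ n {p} (v : Vector (V (B (suc n))) (suc (suc p))) i →
    Lower n v (toℕ i) (ψ n (ones (suc (suc n))) v (θ p 0 (basis₂ p 0 i zero)))
  θ-Lower n {p} v i = record
    { slice₀ = λ x → trans (ψ-apply n _ v w x zero)
        (sum-single-term (λ i′ → w (i′ , zero)) v (suc (toℕ i)) (- 1#) x
          (λ i′ i′≡1+i → trans (w-row₀ i′) (-‿cong (basis₂-same (suc p) 1 zero (≡.sym i′≡1+i))))
          (λ i′ i′≢1+i → trans (w-row₀ i′)
            (trans (-‿cong (basis₂-≢ˡ (suc p) 1 zero zero (i′≢1+i ∘ ≡.sym))) -0#≈0#)))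
    ; slice₁ = λ x → trans (ψ-apply n _ v w x (suc zero))
        (sum-single-term (λ i′ → w (i′ , suc zero)) v (toℕ i) (fromNat d) x
          (λ i′ i′≡i → trans (w-row₁ i′) (trans
            (*-congˡ (basis₂-same (suc p) 1 (suc zero) (≡.trans (Fin.toℕ-inject₁ i) (≡.sym i′≡i))))
            (*-identityʳ (fromNat d))))
          (λ i′ i′≢i → trans (w-row₁ i′) (*-vanishesʳ (fromNat d)
            (basis₂-≢ˡ (suc p) 1 (suc zero) (suc zero) λ eq →
              i′≢i (≡.trans (≡.sym eq) (Fin.toℕ-inject₁ i))))))
    }
    where
    d = suc p ∸ toℕ i
    w = θ p 0 (basis₂ p 0 i zero)

    w-apply : ∀ i′ j → w (i′ , j) ≈
      fromNat d * basis₂ (suc p) 1 (inject₁ i) (suc zero) (i′ , j)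
      + - (fromNat 1 * basis₂ (suc p) 1 (suc i) zero (i′ , j))
    w-apply i′ j = linear-basis 2 (pair p 0)
      (λ (i , j) →
         fromNat (suc p ∸ toℕ i) ·ᵥ basis₂ (suc p) 1 (inject₁ i) (suc j)
         +ᵥ -ᵥ (fromNat (1 ∸ toℕ j) ·ᵥ basis₂ (suc p) 1 (suc i) (inject₁ j)))
      (i , zero) (i′ , j)

    w-row₀ : ∀ i′ → w (i′ , zero) ≈ - basis₂ (suc p) 1 (suc i) zero (i′ , zero)
    w-row₀ i′ = trans (w-apply i′ zero) (trans
      (+-cong (*-vanishesʳ (fromNat d) (basis₂-≢ʳ (suc p) 1 (inject₁ i) i′ λ ()))
              (-‿cong (trans (*-congʳ fromNat-1) (*-identityˡ _))))
      (+-identityˡ _))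

    w-row₁ : ∀ i′ → w (i′ , suc zero) ≈
             fromNat d * basis₂ (suc p) 1 (inject₁ i) (suc zero) (i′ , suc zero)
    w-row₁ i′ = trans (w-apply i′ (suc zero)) (trans
      (+-congˡ (trans (-‿cong (*-vanishesʳ (fromNat 1) (basis₂-≢ʳ (suc p) 1 (suc i) i′ λ ()))) -0#≈0#))
      (+-identityʳ _))

  -- Induction over all chains

  -- The squared norm of the first vector is suc d, hence nonzero.
  GramChain : ∀ n → Seq (V (B n)) → Set ℓ
  GramChain n s = Σ[ d ∈ ℕ ] Gram n s (suc d)

  chains : ∀ n → List (Seq (V (B n)))
  chains n = L n (ones n)

  children : ∀ n → Seq (V (B (suc n))) → List (Seq (V (B (suc (suc n)))))
  children n (l , v) = map (mapSeq (ψ n (ones (suc (suc n))) v)) (J l 1)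

  -- Distinct clauses of `J` handle p = 0 and p > 0, the first running through the second
  -- coordinate. Both are brought to the form (i,0).
  J-chain : ∀ p → Σ[ w ∈ Vector (V (M₂ p 0)) (suc p) ]
            J p 0 ≡ (p , w) ∷ [] × (∀ i → w i ≡ basis₂ p 0 i zero)
  J-chain zero    = _ , ≡.refl , λ { zero → ≡.refl }
  J-chain (suc p) = _ , ≡.refl , λ i → ≡.refl

  children-Gram : ∀ n s → GramChain (suc n) s →
                  All (GramChain (suc (suc n))) (children n s) × AllPairs (Cross (suc (suc n))) (children n s)
  children-Gram n (zero , v) (d , G) =
      (d , upper-Gram ≡.refl λ k →
        vSum-Upper n v (toℕ k) (basis₂ 0 1 zero k) λ { zero j → basis₂-vSum k j }) ∷ []
    , [] ∷ []
    where open UpperStep n G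
  children-Gram n (suc p , v) (d , G) with J-chain p
  ... | w , eq , w≡basis rewrite eq =
      (d , upper-Gram (ℕ.+-comm (suc p) 1) upper)
      -- `lowerStart p (suc d)` reduces to a successor, so unification finds the witness that it is
      -- nonzero.
      ∷ (_ , lower-Gram lower) ∷ []
    , ((λ i j → upper-lower-orthogonal {toℕ i} {toℕ j} (upper i) (lower j)) ∷ []) ∷ [] ∷ []
    where
    open UpperStep n G
    open LowerStep n G
    upper : ∀ j → Upper n v (toℕ j) (ψ n (ones (suc (suc n))) v (vSum (suc p) 1 (toℕ j)))
    upper j = vSum-Upper n v (toℕ j) _ λ _ _ → refl
    lower : ∀ i → Lower n v (toℕ i) (ψ n (ones (suc (suc n))) v (θ p 0 (w i)))
    lower i = ≡.subst (λ b → Lower n v (toℕ i) (ψ n (ones (suc (suc n))) v (θ p 0 b)))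
                      (≡.sym (w≡basis i)) (θ-Lower n v i)

  basis-Gram : Gram 1 (1 , basis 1 (ones 1)) 1
  basis-Gram = record
    { orthogonal = λ {i} {j} i≢j → trans (row i j) (trans
        (conj-cong (basis-off-diagonal 1 (ones 1) (i≢j ∘ ≡.sym))) conj-0#)
    ; normSq = λ where
        zero       → trans (row zero zero) (trans conj-1# (sym fromNat-1))
        (suc zero) → trans (row (suc zero) (suc zero)) (trans conj-1# (sym fromNat-1))
    }
    where
    row : ∀ i j → ⟪_,_⟫ {1} (basis 1 (ones 1) i) (basis 1 (ones 1) j) ≈ conj (basis 1 (ones 1) j i)
    row i j = trans
      (sum-single (λ x → basis 1 (ones 1) i x * conj (basis 1 (ones 1) j x)) i λ x x≢i →
        trans (*-congʳ (basis-off-diagonal 1 (ones 1) (x≢i ∘ ≡.sym))) (zeroˡ _))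
      (trans (*-congʳ (basis-diagonal 1 (ones 1) i)) (*-identityˡ _))

  children-cross : ∀ n s t → Cross (suc n) s t →
    All (λ s′ → All (Cross (suc (suc n)) s′) (children n t)) (children n s)
  children-cross n (l , v) (m , v′) v⊥v′ =
    All.map⁺ (All.universal (λ (_ , w) →
      All.map⁺ (All.universal (λ (_ , w′) i j → ψ-cross n v v′ v⊥v′ (w i) (w′ j)) (J m 1))) (J l 1))

  -- Two chains of the next level either come from the same chain or from two mutually orthogonal
  -- ones; `AllPairs.concat⁺` separates the two cases.
  chains-Gram : ∀ n → All (GramChain (suc n)) (chains (suc n)) × AllPairs (Cross (suc n)) (chains (suc n))
  chains-Gram zero    = (0 , basis-Gram) ∷ [] , [] ∷ []
  chains-Gram (suc n) with chains-Gram n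
  ... | gram , cross =
      All.concat⁺ (All.map⁺ (All.map (λ {s} g → proj₁ (children-Gram n s g)) gram))
    , AllPairs.concat⁺
        (All.map⁺ (All.map (λ {s} g → proj₂ (children-Gram n s g)) gram))
        (AllPairs.map⁺ (AllPairs.map (λ {s} {t} → children-cross n s t) cross))

  elements-orthogonal : ∀ n →
    AllPairs (λ v w → ⟪_,_⟫ {suc n} v w ≈ 0#) (concatMap (λ (l , v) → tabulate v) (chains (suc n)))
  elements-orthogonal n with chains-Gram n
  ... | gram , cross = AllPairs.concat⁺
    (All.map⁺ (All.map (λ (_ , G) → AllPairs.tabulate⁺ (Gram.orthogonal G)) gram))
    (AllPairs.map⁺ (AllPairs.map (λ v⊥w → All.tabulate⁺ λ i → All.tabulate⁺ (v⊥w i)) cross))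

-- The commutative ring ℂ

module ComplexRing {c ℓ₁ ℓ₂ ℓ₃} (ℝ : RealNumbers c ℓ₁ ℓ₂ ℓ₃) where
  open Complex ℝ
  private
    module R = CommutativeRing (RealNumbers.commutativeRing ℝ)
  open RingProperties R.ring using (-0#≈0#; -‿distribˡ-*; -‿distribʳ-*)
  open AbelianGroupProperties R.+-abelianGroup using (⁻¹-∙-comm)
  open CommutativeSemigroupProperties R.+-commutativeSemigroup using (interchange)
  open SemiringSolver R.commutativeSemiring

  private
    module C = RawRing rawRing

    isAbelianGroup : IsAbelianGroup C._≈_ C._+_ C.0# C.-_
    isAbelianGroup = record
      { isGroup = record
        { isMonoid = record
          { isSemigroup = record
            { isMagma = record
              { isEquivalence = record
                { refl = R.refl , R.refl
                ; sym = λ (p , q) → R.sym p , R.sym q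
                ; trans = λ (p , q) (p′ , q′) → R.trans p p′ , R.trans q q′
                }
              ; ∙-cong = λ (p , q) (p′ , q′) → R.+-cong p p′ , R.+-cong q q′
              }
            ; assoc = λ _ _ _ → R.+-assoc _ _ _ , R.+-assoc _ _ _
            }
          ; identity = (λ _ → R.+-identityˡ _ , R.+-identityˡ _)
                     , (λ _ → R.+-identityʳ _ , R.+-identityʳ _)
          }
        ; inverse = (λ _ → R.-‿inverseˡ _ , R.-‿inverseˡ _)
                  , (λ _ → R.-‿inverseʳ _ , R.-‿inverseʳ _)
        ; ⁻¹-cong = λ (p , q) → R.-‿cong p , R.-‿cong q
        }
      ; comm = λ _ _ → R.+-comm _ _ , R.+-comm _ _
      }

    open IsAbelianGroup isAbelianGroup using (setoid) renaming (∙-cong to +-cong)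
    open Consequences setoid using (comm∧idˡ⇒id; comm∧distrˡ⇒distr)

    -- Established first, so that identity and distributivity need checking on one side only.
    *-comm : Commutative C._≈_ C._*_
    *-comm _ _ =
        R.+-cong (R.*-comm _ _) (R.-‿cong (R.*-comm _ _))
      , R.trans (R.+-comm _ _) (R.+-cong (R.*-comm _ _) (R.*-comm _ _))

  commutativeRing : CommutativeRing c ℓ₁
  commutativeRing = record
    { isCommutativeRing = record
      { isRing = record
        { +-isAbelianGroup = isAbelianGroup
        ; *-cong = λ (p , q) (p′ , q′) →
              R.+-cong (R.*-cong p p′) (R.-‿cong (R.*-cong q q′))
            , R.+-cong (R.*-cong p q′) (R.*-cong q p′)
        -- The solver knows no negation, so it is applied after moving every
        -- negation onto a variable, which becomes a variable of its own.
        ; *-assoc = λ (a +i b) (c +i d) (e +i f) →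
              R.trans (R.+-cong (R.*-congʳ (R.+-congˡ (-‿distribʳ-* b d))) (-‿distribʳ-* _ f))
                (R.trans
                  (solve 7 (λ a b c d d′ e f′ →
                    (a :* c :+ b :* d′) :* e :+ (a :* d :+ b :* c) :* f′ :=
                    a :* (c :* e :+ d :* f′) :+ b :* (c :* f′ :+ d′ :* e))
                    R.refl a b c d (R.- d) e (R.- f))
                  (R.sym (R.+-cong
                    (R.*-congˡ (R.+-congˡ (-‿distribʳ-* d f)))
                    (R.trans (-‿distribʳ-* b _) (R.*-congˡ (R.trans (R.sym (⁻¹-∙-comm _ _))
                      (R.+-cong (-‿distribʳ-* c f) (-‿distribˡ-* d e))))))))
            , R.trans (R.+-congʳ (R.*-congʳ (R.+-congˡ (-‿distribʳ-* b d))))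
                (R.trans
                  (solve 7 (λ a b c d d′ e f →
                    (a :* c :+ b :* d′) :* f :+ (a :* d :+ b :* c) :* e :=
                    a :* (c :* f :+ d :* e) :+ b :* (c :* e :+ d′ :* f))
                    R.refl a b c d (R.- d) e f)
                  (R.+-congˡ (R.*-congˡ (R.+-congˡ (R.sym (-‿distribˡ-* d f))))))
        ; *-identity = comm∧idˡ⇒id *-comm λ z →
              R.trans (R.+-cong (R.*-identityˡ _) (R.trans (R.-‿cong (R.zeroˡ _)) -0#≈0#)) (R.+-identityʳ _)
            , R.trans (R.+-cong (R.*-identityˡ _) (R.zeroˡ _)) (R.+-identityʳ _)
        ; distrib = comm∧distrˡ⇒distr +-cong *-comm λ _ _ _ →
              R.trans
                (R.+-cong (R.distribˡ _ _ _) (R.trans (R.-‿cong (R.distribˡ _ _ _)) (R.sym (⁻¹-∙-comm _ _))))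
                (interchange _ _ _ _)
            , R.trans (R.+-cong (R.distribˡ _ _ _) (R.distribˡ _ _ _)) (interchange _ _ _ _)
        }
      ; *-comm = *-comm
      }
    }

-- Positivity and square roots in ℝ

module SquareRoots {c ℓ₁ ℓ₂ ℓ₃} (ℝ : RealNumbers c ℓ₁ ℓ₂ ℓ₃) where
  open RealNumbers ℝ hiding (zero)
  open CommutativeRing commutativeRing using (ring; semiring; *-commutativeSemigroup)
  open IsStrictPartialOrder isStrictPartialOrder
    using () renaming (irrefl to <-irrefl; trans to <-trans; <-respˡ-≈ to <-respˡ; <-respʳ-≈ to <-respʳ)
  open RingProperties ring using (-1*x≈-x; -‿involutive; [y-z]x≈yx-zx)
  open CommutativeSemigroupProperties *-commutativeSemigroup using (interchange)
  open HeytingProperties heytingCommutativeRing using (1#0; invertibleˡ⇒#; x-0≈x)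
  open SemiringMult semiring using (×1-homo-*)
  open SetoidReasoning setoid

  -- 1 is apart from 0, and 1 < 0 would give 0 < -1, hence 0 < (-1)(-1) = 1.
  0<1 : 0# < 1#
  0<1 with #⇒<⊎> 1#0
  ... | inj₂ 0<1 = 0<1
  ... | inj₁ 1<0 = contradiction (<-trans 1<0 (<-respʳ -1*-1≈1 (*-pos 0<-1 0<-1))) (<-irrefl refl)
    where
    0<-1 : 0# < - 1#
    0<-1 = <-respˡ (-‿inverseʳ 1#) (<-respʳ (+-identityˡ (- 1#)) (+-monoˡ-< (- 1#) 1<0))
    -1*-1≈1 : - 1# * - 1# ≈ 1#
    -1*-1≈1 = trans (-1*x≈-x (- 1#)) (-‿involutive 1#)

  +-pos : ∀ {x y} → 0# < x → 0# < y → 0# < x + y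
  +-pos {x} {y} 0<x 0<y = <-trans 0<y (<-respˡ (+-identityˡ y) (+-monoˡ-< y 0<x))

  fromNat-pos : ∀ n → .{{NonZero n}} → 0# < fromNat n
  fromNat-pos (suc zero)    = <-respʳ (sym (+-identityʳ 1#)) 0<1
  fromNat-pos (suc (suc n)) = +-pos 0<1 (fromNat-pos (suc n))

  fromNat-* : ∀ m n → fromNat (m ℕ.* n) ≈ fromNat m * fromNat n
  fromNat-* = ×1-homo-*

  pos⇒nonneg : ∀ {x} → 0# < x → 0# ≤ x
  pos⇒nonneg 0<x x<0 = <-irrefl refl (<-trans 0<x x<0)

  nonneg∧#⇒pos : ∀ {x} → 0# ≤ x → x # 0# → 0# < x
  nonneg∧#⇒pos 0≤x x#0 with #⇒<⊎> x#0
  ... | inj₁ x<0 = contradiction x<0 0≤x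
  ... | inj₂ 0<x = 0<x

  pos⇒# : ∀ {x} → 0# < x → x # 0#
  pos⇒# 0<x = #-sym (<⇒# 0<x)

  -- If z inverts x y, then z x inverts y, and invertible elements are apart from 0. The differences
  -- with 0 appear because invertibility is stated for differences.
  x*y#0⇒y#0 : ∀ {x y} → x * y # 0# → y # 0#
  x*y#0⇒y#0 {x} {y} xy#0 with #⇒invertible xy#0
  ... | z , z*xy≈1 , _ = invertibleˡ⇒# (z * x , (begin
    z * x * (y - 0#)   ≈⟨ *-congˡ (x-0≈x y) ⟩
    z * x * y          ≈⟨ *-assoc z x y ⟩
    z * (x * y)        ≈⟨ *-congˡ (x-0≈x (x * y)) ⟨
    z * (x * y - 0#)   ≈⟨ z*xy≈1 ⟩
    1#                 ∎))

  -- Nonnegativity is only a negated inequality; strictness comes from √x √x = x being apart from 0.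
  √-pos : ∀ {x} → 0# < x → 0# < √ x
  √-pos 0<x = nonneg∧#⇒pos (√-nonneg (pos⇒nonneg 0<x))
    (x*y#0⇒y#0 (pos⇒# (<-respʳ (sym (√-square (pos⇒nonneg 0<x))) 0<x)))

  -- By tightness it is enough to refute x # y: then x - y is invertible, and (x - y)(x + y) = 0
  -- forces x + y = 0 against positivity.
  square-injective : ∀ {x y} → 0# < x → 0# < y → x * x ≈ y * y → x ≈ y
  square-injective {x} {y} 0<x 0<y x²≈y² = proj₁ (tight x y) λ x#y → absurd (#⇒invertible x#y)
    where
    [x-y][x+y]≈0 : (x - y) * (x + y) ≈ 0#
    [x-y][x+y]≈0 = begin
      (x - y) * (x + y)                 ≈⟨ distribˡ (x - y) x y ⟩
      (x - y) * x + (x - y) * y         ≈⟨ +-cong ([y-z]x≈yx-zx x x y) ([y-z]x≈yx-zx y x y) ⟩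
      (x * x - y * x) + (x * y - y * y) ≈⟨ +-congˡ (+-cong (*-comm x y) (-‿cong (sym x²≈y²))) ⟩
      (x * x - y * x) + (y * x - x * x) ≈⟨ +-assoc _ _ _ ⟩
      x * x + (- (y * x) + (y * x - x * x)) ≈⟨ +-congˡ (sym (+-assoc _ _ _)) ⟩
      x * x + ((- (y * x) + y * x) - x * x) ≈⟨ +-congˡ (trans (+-congʳ (-‿inverseˡ _)) (+-identityˡ _)) ⟩
      x * x - x * x                     ≈⟨ -‿inverseʳ _ ⟩
      0#                                ∎

    absurd : ¬ _
    absurd (z , z[x-y]≈1 , _) = <-irrefl (sym x+y≈0) (+-pos 0<x 0<y)
      where
      x+y≈0 : x + y ≈ 0#
      x+y≈0 = begin
        x + y                   ≈⟨ *-identityˡ _ ⟨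
        1# * (x + y)            ≈⟨ *-congʳ z[x-y]≈1 ⟨
        z * (x - y) * (x + y)   ≈⟨ *-assoc _ _ _ ⟩
        z * ((x - y) * (x + y)) ≈⟨ *-congˡ [x-y][x+y]≈0 ⟩
        z * 0#                  ≈⟨ zeroʳ z ⟩
        0#                      ∎

  √-* : ∀ {x y} → 0# < x → 0# < y → √ (x * y) ≈ √ x * √ y
  √-* {x} {y} 0<x 0<y = square-injective (√-pos (*-pos 0<x 0<y)) (*-pos (√-pos 0<x) (√-pos 0<y)) (begin
    √ (x * y) * √ (x * y)     ≈⟨ √-square (pos⇒nonneg (*-pos 0<x 0<y)) ⟩
    x * y                     ≈⟨ *-cong (√-square (pos⇒nonneg 0<x)) (√-square (pos⇒nonneg 0<y)) ⟨
    √ x * √ x * (√ y * √ y)   ≈⟨ interchange _ _ _ _ ⟩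
    √ x * √ y * (√ x * √ y)   ∎)

  √-x² : ∀ {x} → 0# < x → √ (x * x) ≈ x
  √-x² 0<x = square-injective (√-pos (*-pos 0<x 0<x)) 0<x (√-square (pos⇒nonneg (*-pos 0<x 0<x)))

  √fromNat-* : ∀ m n .{{_ : NonZero m}} .{{_ : NonZero n}} →
               √ (fromNat (m ℕ.* n)) ≈ √ (fromNat m) * √ (fromNat n)
  √fromNat-* m n = trans (√-cong (fromNat-* m n)) (√-* (fromNat-pos m) (fromNat-pos n))

  √fromNat-# : ∀ m .{{_ : NonZero m}} → √ (fromNat m) # 0#
  √fromNat-# m = pos⇒# (√-pos (fromNat-pos m))

  /-unique : ∀ {x y z} (y#0 : y # 0#) → x ≈ z * y → x / y ⟨ y#0 ⟩ ≈ z
  /-unique {x} {y} {z} y#0 x≈zy with #⇒invertible y#0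
  ... | w , _ , y*w≈1 = begin
    x * w            ≈⟨ *-congʳ x≈zy ⟩
    z * y * w        ≈⟨ *-assoc z y w ⟩
    z * (y * w)      ≈⟨ *-congˡ (*-congʳ (x-0≈x y)) ⟨
    z * ((y - 0#) * w) ≈⟨ *-congˡ y*w≈1 ⟩
    z * 1#           ≈⟨ *-identityʳ z ⟩
    z                ∎

-- From ranks u to positions u - k

2k+[u∸k]≡k+u : ∀ {k u} → k ℕ.≤ u → 2 ℕ.* k ℕ.+ (u ∸ k) ≡ k ℕ.+ u
2k+[u∸k]≡k+u {k} {u} k≤u = begin
  k ℕ.+ (k ℕ.+ 0) ℕ.+ (u ∸ k) ≡⟨ ℕ.+-assoc k (k ℕ.+ 0) (u ∸ k) ⟩
  k ℕ.+ (k ℕ.+ 0 ℕ.+ (u ∸ k)) ≡⟨ ≡.cong (λ m → k ℕ.+ (m ℕ.+ (u ∸ k))) (ℕ.+-identityʳ k) ⟩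
  k ℕ.+ (k ℕ.+ (u ∸ k))       ≡⟨ ≡.cong (k ℕ.+_) (ℕ.m+[n∸m]≡n k≤u) ⟩
  k ℕ.+ u                     ∎
  where open ≡-Reasoning

u+1∸k≡1+[u∸k] : ∀ {k u} → k ℕ.≤ u → u ℕ.+ 1 ∸ k ≡ suc (u ∸ k)
u+1∸k≡1+[u∸k] {k} {u} k≤u = ≡.trans (≡.cong (_∸ k) (ℕ.+-comm u 1)) (ℕ.+-∸-assoc 1 k≤u)

n∸2k∸[u∸k]≡n∸k∸u : ∀ n {k u} → k ℕ.≤ u → n ∸ 2 ℕ.* k ∸ (u ∸ k) ≡ n ∸ k ∸ u
n∸2k∸[u∸k]≡n∸k∸u n {k} {u} k≤u = begin
  n ∸ 2 ℕ.* k ∸ (u ∸ k)     ≡⟨ ℕ.∸-+-assoc n (2 ℕ.* k) (u ∸ k) ⟩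
  n ∸ (2 ℕ.* k ℕ.+ (u ∸ k)) ≡⟨ ≡.cong (n ∸_) (2k+[u∸k]≡k+u k≤u) ⟩
  n ∸ (k ℕ.+ u)             ≡⟨ ℕ.∸-+-assoc n k u ⟨
  n ∸ k ∸ u                 ∎
  where open ≡-Reasoning

u∸k≤n∸2k : ∀ n k {u} → u ℕ.≤ n ∸ k → u ∸ k ℕ.≤ n ∸ 2 ℕ.* k
u∸k≤n∸2k n k {u} u≤n-k = begin
  u ∸ k             ≤⟨ ℕ.∸-monoˡ-≤ k u≤n-k ⟩
  n ∸ k ∸ k         ≡⟨ ℕ.∸-+-assoc n k k ⟩
  n ∸ (k ℕ.+ k)     ≡⟨ ≡.cong (λ m → n ∸ (k ℕ.+ m)) (ℕ.+-identityʳ k) ⟨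
  n ∸ 2 ℕ.* k       ∎
  where open ℕ.≤-Reasoning

-- Norm ratios in a symmetric chain

module NormRatios {c ℓ₁ ℓ₂ ℓ₃} (ℝ : RealNumbers c ℓ₁ ℓ₂ ℓ₃) where

  open Complex ℝ
  open BooleanBTK ℝ using (SymmetricChain; norm)
  open SymmetricChain
  open ComplexRing ℝ using () renaming (commutativeRing to ℂ-commutativeRing)
  private
    module R = RealNumbers ℝ
    module ℂR = CommutativeRing ℂ-commutativeRing
  open RingProperties (CommutativeRing.ring R.commutativeRing)
    using (-0#≈0#; -‿distribˡ-*; -‿distribʳ-*; -‿involutive)
  open AbelianGroupProperties (CommutativeRing.+-abelianGroup R.commutativeRing) using (⁻¹-∙-comm)
  open SquareRoots ℝ
  open SetoidReasoning (CommutativeRing.setoid R.commutativeRing)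

  conj-isHomomorphism : RingMorphisms.IsRingHomomorphism ℂR.rawRing ℂR.rawRing conj
  conj-isHomomorphism = record
    { isSemiringHomomorphism = record
      { isNearSemiringHomomorphism = record
        { +-isMonoidHomomorphism = record
          { isMagmaHomomorphism = record
            { isRelHomomorphism = record { cong = λ (p , q) → p , R.-‿cong q }
            ; homo = λ z w → R.refl , R.sym (⁻¹-∙-comm (im z) (im w))
            }
          ; ε-homo = R.refl , -0#≈0#
          }
        ; *-homo = λ z w →
              R.+-congˡ (R.-‿cong (R.sym (neg*neg (im z) (im w))))
            , R.trans (R.sym (⁻¹-∙-comm _ _)) (R.+-cong (-‿distribʳ-* (re z) (im w)) (-‿distribˡ-* (im z) (re w)))
        }
      ; 1#-homo = R.refl , -0#≈0#
      }
    ; -‿homo = λ z → R.refl , R.refl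
    }
    where
    neg*neg : ∀ a b → (R.- a) R.* (R.- b) R.≈ a R.* b
    neg*neg a b = R.trans (R.sym (-‿distribˡ-* a (R.- b)))
      (R.trans (R.-‿cong (R.sym (-‿distribʳ-* a b))) (-‿involutive (a R.* b)))

  open HermitianBTK ℂ-commutativeRing conj conj-isHomomorphism public
    using (Gram; chains-Gram; elements-orthogonal)

  re-fromNat : ∀ m → re (LinearBTK.fromNat rawRing m) R.≈ R.fromNat m
  re-fromNat zero    = R.refl
  re-fromNat (suc m) = R.+-congˡ (re-fromNat m)

  norm-Gram : ∀ n {s d} → Gram n s d → ∀ i →
              norm n (proj₂ s i) R.≈ R.√ (R.fromNat (sqNorm (proj₁ s) d (toℕ i)))
  norm-Gram n {l , _} {d} G i =
    R.√-cong (R.trans (proj₁ (Gram.normSq G i)) (re-fromNat (sqNorm l d (toℕ i))))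

  module _ n {k} (x : SymmetricChain n k) {d} (G : Gram n (n ∸ 2 ℕ.* k , vectors x) (suc d)) where

    normAt-Gram : ∀ u (k≤u : k ℕ.≤ u) (u≤n-k : u ℕ.≤ n ∸ k) →
      normAt x u k≤u u≤n-k R.≈ R.√ (R.fromNat (sqNorm (n ∸ 2 ℕ.* k) (suc d) (u ∸ k)))
    normAt-Gram u k≤u u≤n-k = R.trans
      (norm-Gram n G (fromℕ< (s≤s (u∸k≤n∸2k n k u≤n-k))))
      (R.reflexive (≡.cong (λ i → R.√ (R.fromNat (sqNorm (n ∸ 2 ℕ.* k) (suc d) i)))
        (Fin.toℕ-fromℕ< (s≤s (u∸k≤n∸2k n k u≤n-k)))))

    normAt-# : ∀ u (k≤u : k ℕ.≤ u) (u≤n-k : u ℕ.≤ n ∸ k) → normAt x u k≤u u≤n-k R.# R.0#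
    normAt-# u k≤u u≤n-k = #-congʳ (R.sym (normAt-Gram u k≤u u≤n-k))
      (√fromNat-# _ {{sqNorm-nonZero (n ∸ 2 ℕ.* k) (suc d) (u ∸ k) (u∸k≤n∸2k n k u≤n-k)}})
      where open HeytingProperties R.heytingCommutativeRing using (#-congʳ)

    -- One step of the recursion at position i = u - k in length l = n - 2k. The value d of the
    -- chain cancels, which is what (ii) rests on.
    normAt-ratio : ∀ u (k≤u : k ℕ.≤ u) (u<n-k : u ℕ.< n ∸ k) →
      normAt x (suc u) (ℕ.m≤n⇒m≤1+n k≤u) u<n-k
        R./ normAt x u k≤u (ℕ.<⇒≤ u<n-k) ⟨ normAt-# u k≤u (ℕ.<⇒≤ u<n-k) ⟩
      R.≈ R.√ (R.fromNat ((u ℕ.+ 1 ∸ k) ℕ.* (n ∸ k ∸ u)))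
    normAt-ratio u k≤u u<n-k = /-unique (normAt-# u k≤u (ℕ.<⇒≤ u<n-k)) (begin
      normAt x (suc u) (ℕ.m≤n⇒m≤1+n k≤u) u<n-k
        ≈⟨ normAt-Gram (suc u) (ℕ.m≤n⇒m≤1+n k≤u) u<n-k ⟩
      R.√ (R.fromNat (N (suc u ∸ k)))
        ≡⟨ ≡.cong (λ i → R.√ (R.fromNat (N i))) (ℕ.+-∸-assoc 1 k≤u) ⟩
      R.√ (R.fromNat (suc i ℕ.* (l ∸ i) ℕ.* N i))
        ≡⟨ ≡.cong₂ (λ a b → R.√ (R.fromNat (a ℕ.* b ℕ.* N i)))
             (≡.sym (u+1∸k≡1+[u∸k] k≤u))
             (n∸2k∸[u∸k]≡n∸k∸u n k≤u) ⟩
      R.√ (R.fromNat ((u ℕ.+ 1 ∸ k) ℕ.* (n ∸ k ∸ u) ℕ.* N i))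
        ≈⟨ √fromNat-* ((u ℕ.+ 1 ∸ k) ℕ.* (n ∸ k ∸ u)) (N i) {{rootNonZero}} {{NᵢNonZero}} ⟩
      R.√ (R.fromNat ((u ℕ.+ 1 ∸ k) ℕ.* (n ∸ k ∸ u))) R.* R.√ (R.fromNat (N i))
        ≈⟨ R.*-congˡ (normAt-Gram u k≤u (ℕ.<⇒≤ u<n-k)) ⟨
      R.√ (R.fromNat ((u ℕ.+ 1 ∸ k) ℕ.* (n ∸ k ∸ u))) R.* normAt x u k≤u (ℕ.<⇒≤ u<n-k) ∎)
      where
      l = n ∸ 2 ℕ.* k
      i = u ∸ k
      N = sqNorm l (suc d)
      rootNonZero = ℕ.m*n≢0 (u ℕ.+ 1 ∸ k) (n ∸ k ∸ u)
        {{≡.subst NonZero (≡.sym (u+1∸k≡1+[u∸k] k≤u)) _}} {{ℕ.>-nonZero (ℕ.m<n⇒0<n∸m u<n-k)}}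
      NᵢNonZero = sqNorm-nonZero l (suc d) i (u∸k≤n∸2k n k (ℕ.<⇒≤ u<n-k))

  √C-# : ∀ n k → k ℕ.≤ n → R.√ (R.fromNat (n C k)) R.# R.0#
  √C-# n k k≤n = √fromNat-# (n C k) {{C-nonZero n k k≤n}}

  -- Absorption multiplied by b gives b² C(l,i) = a b C(l,a); now take roots. Equations for a and b
  -- admit the forms in which (iii) writes the two factors.
  root-binomial : ∀ l {i a b} → i ℕ.< l → a ≡ suc i → b ≡ l ∸ i →
    (C#0 : R.√ (R.fromNat (l C a)) R.# R.0#) →
    R.√ (R.fromNat (a ℕ.* b)) R.≈
    R.fromNat b R.* R.√ (R.fromNat (l C i)) R.* R.inverse (R.√ (R.fromNat (l C a))) C#0
  root-binomial l {i} i<l ≡.refl ≡.refl C#0 = R.sym (/-unique C#0 (begin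
    R.fromNat b R.* R.√ (R.fromNat (l C i))
      ≈⟨ R.*-congʳ (R.trans (R.√-cong (fromNat-* b b)) (√-x² (fromNat-pos b))) ⟨
    R.√ (R.fromNat (b ℕ.* b)) R.* R.√ (R.fromNat (l C i))
      ≈⟨ √fromNat-* (b ℕ.* b) (l C i) ⟨
    R.√ (R.fromNat (b ℕ.* b ℕ.* (l C i)))
      ≡⟨ ≡.cong (λ m → R.√ (R.fromNat m)) absorb ⟩
    R.√ (R.fromNat (suc i ℕ.* b ℕ.* (l C suc i)))
      ≈⟨ √fromNat-* (suc i ℕ.* b) (l C suc i) ⟩
    R.√ (R.fromNat (suc i ℕ.* b)) R.* R.√ (R.fromNat (l C suc i)) ∎))
    where
    b = l ∸ i
    instance
      b≢0 : NonZero b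
      b≢0 = ℕ.>-nonZero (ℕ.m<n⇒0<n∸m i<l)
      bb≢0 : NonZero (b ℕ.* b)
      bb≢0 = ℕ.m*n≢0 b b
      ib≢0 : NonZero (suc i ℕ.* b)
      ib≢0 = ℕ.m*n≢0 (suc i) b
      C₀≢0 : NonZero (l C i)
      C₀≢0 = C-nonZero l i (ℕ.<⇒≤ i<l)
      C₁≢0 : NonZero (l C suc i)
      C₁≢0 = C-nonZero l (suc i) i<l
    absorb : b ℕ.* b ℕ.* (l C i) ≡ suc i ℕ.* b ℕ.* (l C suc i)
    absorb = ≡.trans (ℕ.*-assoc b b (l C i)) (≡.trans
      (≡.cong (b ℕ.*_) (≡.sym ([1+k]*nC[1+k]≡[n∸k]*nCk l i)))
      (swap b (suc i) (l C suc i)))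
      where
      swap : ∀ b m X → b ℕ.* (m ℕ.* X) ≡ m ℕ.* b ℕ.* X
      swap = solve-∀

  u∸k<n∸2k : ∀ n {k u} → k ℕ.≤ u → u ℕ.< n ∸ k → u ∸ k ℕ.< n ∸ 2 ℕ.* k
  u∸k<n∸2k n {k} k≤u u<n-k = ≡.subst (ℕ._≤ n ∸ 2 ℕ.* k) (ℕ.+-∸-assoc 1 k≤u) (u∸k≤n∸2k n k u<n-k)

open import Data.Nat using (_+_; _*_; _≤_; _<_; ⌊_/2⌋)
open import Data.Nat.Properties using (<⇒≤; m≤n⇒m≤1+n)

theorem1p2 :
    ∀ {c ℓ₁ ℓ₂ ℓ₃} (ℝ : RealNumbers c ℓ₁ ℓ₂ ℓ₃) →
    let module ℝ = RealNumbers ℝ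
        open BooleanBTK ℝ
        open SymmetricChain
    in
    (n : ℕ) .{{_ : NonZero n}} →
    -- (i)
    AllPairs (Orthogonal n) (O n)
    ×
    -- (ii)
    (∀ k → k ≤ ⌊ n /2⌋ → (x y : SymmetricChain n k) →
     ∀ u (k≤u : k ≤ u) (u<n-k : u < n ∸ k) →
     let ‖xᵤ‖   = normAt x u k≤u (<⇒≤ u<n-k)
         ‖xᵤ₊₁‖ = normAt x (suc u) (m≤n⇒m≤1+n k≤u) u<n-k
         ‖yᵤ‖   = normAt y u k≤u (<⇒≤ u<n-k)
         ‖yᵤ₊₁‖ = normAt y (suc u) (m≤n⇒m≤1+n k≤u) u<n-k
     in
     Σ[ x#0 ∈ ‖xᵤ‖ ℝ.# ℝ.0# ] Σ[ y#0 ∈ ‖yᵤ‖ ℝ.# ℝ.0# ]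
       (‖xᵤ₊₁‖ ℝ./ ‖xᵤ‖ ⟨ x#0 ⟩ ℝ.≈ ‖yᵤ₊₁‖ ℝ./ ‖yᵤ‖ ⟨ y#0 ⟩))
    ×
    -- (iii)
    (∀ k → k ≤ ⌊ n /2⌋ → (x : SymmetricChain n k) →
     ∀ u (k≤u : k ≤ u) (u<n-k : u < n ∸ k) →
     let ‖xᵤ‖   = normAt x u k≤u (<⇒≤ u<n-k)
         ‖xᵤ₊₁‖ = normAt x (suc u) (m≤n⇒m≤1+n k≤u) u<n-k
         √C₀    = ℝ.√ (ℝ.fromNat ((n ∸ 2 * k) C (u ∸ k)))
         √C₁    = ℝ.√ (ℝ.fromNat ((n ∸ 2 * k) C (u + 1 ∸ k)))
         root   = ℝ.√ (ℝ.fromNat ((u + 1 ∸ k) * (n ∸ k ∸ u)))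
     in
     Σ[ x#0 ∈ ‖xᵤ‖ ℝ.# ℝ.0# ] Σ[ C₁#0 ∈ √C₁ ℝ.# ℝ.0# ]
       (‖xᵤ₊₁‖ ℝ./ ‖xᵤ‖ ⟨ x#0 ⟩ ℝ.≈ root)
       × (root ℝ.≈ ℝ.fromNat (n ∸ k ∸ u) ℝ.* √C₀ ℝ.* ℝ.inverse √C₁ C₁#0))
theorem1p2 ℝ n@(suc m) = elements-orthogonal m , part-ii , part-iii
  where
  open NormRatios ℝ
  module R = RealNumbers ℝ
  open BooleanBTK ℝ using (SymmetricChain)
  open SymmetricChain

  chain-Gram : ∀ {k} (x : SymmetricChain n k) → Σ[ d ∈ ℕ ] Gram n (n ∸ 2 * k , vectors x) (suc d)
  chain-Gram x = All.lookup (proj₁ (chains-Gram m)) (inO x)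

  part-ii = λ k (_ : k ≤ ⌊ n /2⌋) (x y : SymmetricChain n k) u (k≤u : k ≤ u) (u<n-k : u < n ∸ k) →
    let Gx = proj₂ (chain-Gram x)
        Gy = proj₂ (chain-Gram y)
    in normAt-# n x Gx u k≤u (<⇒≤ u<n-k) , normAt-# n y Gy u k≤u (<⇒≤ u<n-k) ,
       -- Both quotients equal the same root, although x and y may have different initial norms.
       R.trans (normAt-ratio n x Gx u k≤u u<n-k) (R.sym (normAt-ratio n y Gy u k≤u u<n-k))

  part-iii = λ k (_ : k ≤ ⌊ n /2⌋) (x : SymmetricChain n k) u (k≤u : k ≤ u) (u<n-k : u < n ∸ k) →
    let Gx   = proj₂ (chain-Gram x)
        i<l  = u∸k<n∸2k n k≤u u<n-k
        C₁#0 = √C-# (n ∸ 2 * k) (u + 1 ∸ k)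
                 (≡.subst (_≤ n ∸ 2 * k) (≡.sym (u+1∸k≡1+[u∸k] k≤u)) i<l)
    in normAt-# n x Gx u k≤u (<⇒≤ u<n-k) , C₁#0 ,
       normAt-ratio n x Gx u k≤u u<n-k ,
       root-binomial (n ∸ 2 * k) i<l (u+1∸k≡1+[u∸k] k≤u) (≡.sym (n∸2k∸[u∸k]≡n∸k∸u n k≤u)) C₁#0
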